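{- Let $(X,h)$ be an algebra for the monad $\mathcal{L}$ on 2-signatures. Then $\mathcal{F}(X,h)$, as described in the context, is a 2-category, and it carries a cartesian closed 2-category structure whose terminal object, binary products and exponentials are the types $1$, $A\times B$ and $B^A$.
   Context: Types over $X_0$: $A,B::=x\mid1\mid A\times B\mid B^A$. A 2-signature $X$: sorts $X_0$, operations $X_1$ each over a sequent of types, rules $X_2$ each assigned a pair $(G\vdash M,N\colon A)$ of terms of the simply-typed $\lambda$-calculus (unit, products, functions, base types $X_0$, term formers $c\langle\vec M\rangle$ for $c\in X_1$) modulo $\beta\eta$; write $X_2(G\vdash M,N\colon A)$ for the rules over that pair. Reductions $\Gamma\vdash P\colon M\to N\colon A$ are generated by rule application $r\langle P_1,\ldots,P_n\rangle\colon M[\vec M]\to N[\vec N]$ (for $r$ over $(G\vdash M,N\colon A)$, $P_i\colon M_i\to N_i\colon G_i$), vertical composition $P;_{M_2}Q$, and term constructors lifted to reductions ($x$, $()$, $c\langle\vec P\rangle$, $\lambda x.P$, $PQ$, $(P,Q)$, $\pi P$, $\pi' P$); every term $M$ gives $M\colon M\to M$. Substitution $P[Q]=P[N];M'[Q]$ (left whiskering $M'[Q]$ replaces variables by reductions, right whiskering $P[N]$ substitutes terms, structurally). Permutation equivalence $\equiv$: least congruence containing associativity and unit laws for $;$; $(\lambda x.P)Q\equiv P[Q/x]$, $P\equiv\lambda x.(Px)$, $\pi(P,Q)\equiv P$, $\pi'(P,Q)\equiv Q$, $P\equiv(\pi P,\pi'P)$, $P\equiv()$ at type $1$; $r\langle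 P;Q\rangle\equiv M_1[P];r\langle Q\rangle\equiv r\langle P\rangle;M_2[Q]$ for $r$ over $(\Gamma\vdash M_1,M_2\colon A)$; and componentwise commutation of $c\langle-\rangle$, $\lambda$, application, pairing, projections with $;$. $\mathcal{L}(X)$: same sorts and operations, rules over $(G\vdash M,N\colon A)$ the $\equiv$-classes of reductions $G\vdash P\colon M\to N\colon A$. $\eta_X(r)=r\langle x_1,\ldots,x_n\rangle$; $\mu_X\colon\mathcal{L}\mathcal{L}(X)\to\mathcal{L}(X)$ by $\mu(R\langle\vec P\rangle)=R[\mu\vec P]$ and structurally otherwise. An $\mathcal{L}$-algebra is a morphism of 2-signatures $h\colon\mathcal{L}(X)\to X$ with $h\circ\eta_X=\mathrm{id}$ and $h\circ\mathcal{L}(h)=h\circ\mu_X$. $\mathcal{F}(X,h)$ has: objects the types over $X_0$; 1-cells $A\to B$ the terms $x\colon A\vdash M\colon B$ modulo $\beta\eta$, composed by substitution ($N\circ M=N[M/x]$), identities the variables; 2-cells $M\Rightarrow N\colon A\to B$ the rules in $X_2(A\vdash M,N\colon B)$; vertical composite of $\alpha\colon M_1\Rightarrow M_2$ and $\beta\colon M_2\Rightarrow M_3$ is $h(\eta(\alpha);_{M_2}\eta(\beta))$; horizontal composite of $\alpha\colon M\Rightarrow M'\colon A\to B$ and $\beta\colon N\Rightarrow N'\colon B\to C$ is $h(\beta\langle\eta(\alpha)\rangle)$; the identity 2-cell on $M$ is $h(M)$. A cartesian closed 2-category is a 2-category with chosen terminal object, product 2-functor with chosen product diagrams, and chosen exponentials,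 such that the induced functors $\mathcal{C}(D,1)\to1$, $\mathcal{C}(D,A\times B)\to\mathcal{C}(D,A)\times\mathcal{C}(D,B)$ and $\mathcal{C}(D,B^A)\to\mathcal{C}(A\times D,B)$ (via $\mathit{ev}$) are isomorphisms of categories. -}

module Defs where

-- Quotients are rendered with setoids:
--  * terms modulo βη: raw intrinsically-typed terms together with the
--    inductive βη-equality _≈_;
--  * a family of rules "over pairs of βη-classes": a raw-indexed family with
--    a coherent transport along _≈_ (Sig₂.tr, tr-id, tr-tr);
--  * ≡-classes of reductions: raw reductions together with the (heterogeneous)
--    permutation equivalence _≅_; maps out of the quotient are maps on
--    representatives that respect _≅_.

open import Data.List.Base using (List; []; _∷_)
open import Data.Product.Base using (Σ; _×_; _,_)
open import Data.Unit.Base using (⊤; tt)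
open import Relation.Binary.PropositionalEquality.Core using (_≡_)

infixr 7 _⊗_
infixr 6 _⇒_

-- A ⇒ B is the exponential B^A
data Ty (S : Set) : Set where
  ι   : S → Ty S
  𝟙   : Ty S
  _⊗_ : Ty S → Ty S → Ty S
  _⇒_ : Ty S → Ty S → Ty S

Ctx : Set → Set
Ctx S = List (Ty S)

data _∋_ {S : Set} : Ctx S → Ty S → Set where
  here  : ∀ {Γ A} → (A ∷ Γ) ∋ A
  there : ∀ {Γ A B} → Γ ∋ A → (B ∷ Γ) ∋ A

-- operations over a sequent  A₁,…,Aₙ ⊢ B
Arity : Set → Set₁
Arity S = List (Ty S) → Ty S → Set

module Syntax {S : Set} (Op : Arity S) where

  private variable
    A B C : Ty S
    Γ Δ G : Ctx S

  mutual
    data Tm (Γ : Ctx S) : Ty S → Set where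
      var  : Γ ∋ A → Tm Γ A
      unit : Tm Γ 𝟙
      pair : Tm Γ A → Tm Γ B → Tm Γ (A ⊗ B)
      fst  : Tm Γ (A ⊗ B) → Tm Γ A
      snd  : Tm Γ (A ⊗ B) → Tm Γ B
      lam  : Tm (A ∷ Γ) B → Tm Γ (A ⇒ B)
      app  : Tm Γ (A ⇒ B) → Tm Γ A → Tm Γ B
      op   : Op Δ B → Tms Γ Δ → Tm Γ B

    -- a list of terms, one for each type of the second context
    -- (arguments of an operation, or a substitution)
    data Tms (Γ : Ctx S) : Ctx S → Set where
      []  : Tms Γ []
      _∷_ : Tm Γ A → Tms Γ Δ → Tms Γ (A ∷ Δ)

  Ren : Ctx S → Ctx S → Set
  Ren Γ Δ = ∀ {A} → Γ ∋ A → Δ ∋ A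

  liftRen : Ren Γ Δ → Ren (A ∷ Γ) (A ∷ Δ)
  liftRen ρ here      = here
  liftRen ρ (there x) = there (ρ x)

  mutual
    ren : Ren Γ Δ → Tm Γ A → Tm Δ A
    ren ρ (var x)    = var (ρ x)
    ren ρ unit       = unit
    ren ρ (pair M N) = pair (ren ρ M) (ren ρ N)
    ren ρ (fst M)    = fst (ren ρ M)
    ren ρ (snd M)    = snd (ren ρ M)
    ren ρ (lam M)    = lam (ren (liftRen ρ) M)
    ren ρ (app M N)  = app (ren ρ M) (ren ρ N)
    ren ρ (op c Ms)  = op c (rens ρ Ms)

    rens : Ren Γ Δ → Tms Γ G → Tms Δ G
    rens ρ []       = []
    rens ρ (M ∷ Ms) = ren ρ M ∷ rens ρ Ms

  lookup : Tms Γ G → G ∋ A → Tm Γ A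
  lookup (M ∷ Ms) here      = M
  lookup (M ∷ Ms) (there x) = lookup Ms x

  lift : Tms Γ G → Tms (A ∷ Γ) (A ∷ G)
  lift σ = var here ∷ rens there σ

  mutual
    sub : Tm G A → Tms Γ G → Tm Γ A
    sub (var x)    σ = lookup σ x
    sub unit       σ = unit
    sub (pair M N) σ = pair (sub M σ) (sub N σ)
    sub (fst M)    σ = fst (sub M σ)
    sub (snd M)    σ = snd (sub M σ)
    sub (lam M)    σ = lam (sub M (lift σ))
    sub (app M N)  σ = app (sub M σ) (sub N σ)
    sub (op c Ms)  σ = op c (subs Ms σ)

    subs : Tms G Δ → Tms Γ G → Tms Γ Δ
    subs []       σ = []
    subs (M ∷ Ms) σ = sub M σ ∷ subs Ms σ

  idTms : (Γ : Ctx S) → Tms Γ Γ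
  idTms []      = []
  idTms (A ∷ Γ) = lift (idTms Γ)

  varsOf : ∀ {Γ Δ} → Ren Γ Δ → Tms Δ Γ
  varsOf {[]}    ρ = []
  varsOf {A ∷ Γ} ρ = var (ρ here) ∷ varsOf (λ x → ρ (there x))

  infix 4 _≈_ _≈s_

  -- βη-equality: the least congruence containing β and η for →, ×, 1.
  -- The last four constructors are admissible (they hold for βη-equality,
  -- three of them even syntactically); they are included for convenience.
  mutual
    data _≈_ : {Γ : Ctx S} {A : Ty S} → Tm Γ A → Tm Γ A → Set where
      ≈refl  : {M : Tm Γ A} → M ≈ M
      ≈sym   : {M N : Tm Γ A} → M ≈ N → N ≈ M
      ≈trans : {M N P : Tm Γ A} → M ≈ N → N ≈ P → M ≈ P
      pair-cong : {M M' : Tm Γ A} {N N' : Tm Γ B} → M ≈ M' → N ≈ N' → pair M N ≈ pair M' N'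
      fst-cong  : {M M' : Tm Γ (A ⊗ B)} → M ≈ M' → fst M ≈ fst M'
      snd-cong  : {M M' : Tm Γ (A ⊗ B)} → M ≈ M' → snd M ≈ snd M'
      lam-cong  : {M M' : Tm (A ∷ Γ) B} → M ≈ M' → lam M ≈ lam M'
      app-cong  : {M M' : Tm Γ (A ⇒ B)} {N N' : Tm Γ A} → M ≈ M' → N ≈ N' → app M N ≈ app M' N'
      op-cong   : (c : Op Δ B) {Ms Ns : Tms Γ Δ} → Ms ≈s Ns → op c Ms ≈ op c Ns
      β-lam  : (M : Tm (A ∷ Γ) B) (N : Tm Γ A) → app (lam M) N ≈ sub M (N ∷ idTms Γ)
      β-fst  : (M : Tm Γ A) (N : Tm Γ B) → fst (pair M N) ≈ M
      β-snd  : (M : Tm Γ A) (N : Tm Γ B) → snd (pair M N) ≈ N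
      η-lam  : (M : Tm Γ (A ⇒ B)) → M ≈ lam (app (ren there M) (var here))
      η-pair : (M : Tm Γ (A ⊗ B)) → M ≈ pair (fst M) (snd M)
      η-unit : (M : Tm Γ 𝟙) → M ≈ unit
      sub-cong : {M N : Tm G A} → M ≈ N → (σ : Tms Γ G) → sub M σ ≈ sub N σ
      sub-sub  : (M : Tm G A) (σ : Tms Δ G) (τ : Tms Γ Δ) → sub (sub M σ) τ ≈ sub M (subs σ τ)
      sub-id   : (M : Tm Γ A) → sub M (idTms Γ) ≈ M
      ren-sub  : (ρ : Ren G Γ) (M : Tm G A) → ren ρ M ≈ sub M (varsOf ρ)

    data _≈s_ : {Γ Δ : Ctx S} → Tms Γ Δ → Tms Γ Δ → Set where
      []  : {Γ : Ctx S} → _≈s_ {Γ} [] []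
      _∷_ : {M N : Tm Γ A} {Ms Ns : Tms Γ Δ} → M ≈ N → Ms ≈s Ns → (M ∷ Ms) ≈s (N ∷ Ns)

RuleFam : (S : Set) → Arity S → Set₁
RuleFam S Op = (G : Ctx S) (A : Ty S) → Syntax.Tm Op G A → Syntax.Tm Op G A → Set

-- Rules are over pairs of βη-classes: a raw-indexed family
-- with a transport along βη-equality which is independent of the proofs and
-- functorial (this is exactly a family over the quotient).
record Sig₂ : Set₁ where
  field
    Sort : Set
    Op   : Arity Sort
    Rule : RuleFam Sort Op
    tr   : ∀ {G A} {M M' N N' : Syntax.Tm Op G A} →
           Syntax._≈_ Op M M' → Syntax._≈_ Op N N' → Rule G A M N → Rule G A M' N'
    tr-id : ∀ {G A} {M N : Syntax.Tm Op G A}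
            (p : Syntax._≈_ Op M M) (q : Syntax._≈_ Op N N) (r : Rule G A M N) → tr p q r ≡ r
    tr-tr : ∀ {G A} {M M' M'' N N' N'' : Syntax.Tm Op G A}
            (p : Syntax._≈_ Op M M') (q : Syntax._≈_ Op N N')
            (p' : Syntax._≈_ Op M' M'') (q' : Syntax._≈_ Op N' N'')
            (p'' : Syntax._≈_ Op M M'') (q'' : Syntax._≈_ Op N N'')
            (r : Rule G A M N) → tr p' q' (tr p q r) ≡ tr p'' q'' r

module Reductions {S : Set} {Op : Arity S} (R : RuleFam S Op) where

  open Syntax Op

  private variable
    A B : Ty S
    Γ Δ G : Ctx S

  infixl 5 _⨾_

  mutual
    data Red : (Γ : Ctx S) (A : Ty S) → Tm Γ A → Tm Γ A → Set where
      rule  : ∀ {G Γ A} {M N : Tm G A} {Ss Ts : Tms Γ G} →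
              R G A M N → Reds Γ G Ss Ts → Red Γ A (sub M Ss) (sub N Ts)
      _⨾_   : {M₁ M₂ M₃ : Tm Γ A} → Red Γ A M₁ M₂ → Red Γ A M₂ M₃ → Red Γ A M₁ M₃
      -- reductions are between βη-classes
      conv  : {M M' N N' : Tm Γ A} → M ≈ M' → N ≈ N' → Red Γ A M N → Red Γ A M' N'
      rvar  : (x : Γ ∋ A) → Red Γ A (var x) (var x)
      runit : Red Γ 𝟙 unit unit
      rop   : (c : Op Δ B) {Ms Ns : Tms Γ Δ} → Reds Γ Δ Ms Ns → Red Γ B (op c Ms) (op c Ns)
      rlam  : {M N : Tm (A ∷ Γ) B} → Red (A ∷ Γ) B M N → Red Γ (A ⇒ B) (lam M) (lam N)
      rapp  : {M N : Tm Γ (A ⇒ B)} {M' N' : Tm Γ A} →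
              Red Γ (A ⇒ B) M N → Red Γ A M' N' → Red Γ B (app M M') (app N N')
      rpair : {M N : Tm Γ A} {M' N' : Tm Γ B} →
              Red Γ A M N → Red Γ B M' N' → Red Γ (A ⊗ B) (pair M M') (pair N N')
      rfst  : {M N : Tm Γ (A ⊗ B)} → Red Γ (A ⊗ B) M N → Red Γ A (fst M) (fst N)
      rsnd  : {M N : Tm Γ (A ⊗ B)} → Red Γ (A ⊗ B) M N → Red Γ B (snd M) (snd N)

    data Reds : (Γ G : Ctx S) → Tms Γ G → Tms Γ G → Set where
      []  : Reds Γ [] [] []
      _∷_ : {M N : Tm Γ A} {Ms Ns : Tms Γ G} →
            Red Γ A M N → Reds Γ G Ms Ns → Reds Γ (A ∷ G) (M ∷ Ms) (N ∷ Ns)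

  mutual
    reflR : (M : Tm Γ A) → Red Γ A M M
    reflR (var x)    = rvar x
    reflR unit       = runit
    reflR (pair M N) = rpair (reflR M) (reflR N)
    reflR (fst M)    = rfst (reflR M)
    reflR (snd M)    = rsnd (reflR M)
    reflR (lam M)    = rlam (reflR M)
    reflR (app M N)  = rapp (reflR M) (reflR N)
    reflR (op c Ms)  = rop c (reflRs Ms)

    reflRs : (Ms : Tms Γ G) → Reds Γ G Ms Ms
    reflRs []       = []
    reflRs (M ∷ Ms) = reflR M ∷ reflRs Ms

  compRs : {Ms Ns Ps : Tms Γ G} → Reds Γ G Ms Ns → Reds Γ G Ns Ps → Reds Γ G Ms Ps
  compRs []       []       = []
  compRs (P ∷ Ps) (Q ∷ Qs) = (P ⨾ Q) ∷ compRs Ps Qs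

  mutual
    _[_]ʳ : {M N : Tm G A} → Red G A M N → (σ : Tms Γ G) → Red Γ A (sub M σ) (sub N σ)
    _[_]ʳ (rule {M = M} {N} {Ss} {Ts} r Ps) σ =
      conv (≈sym (sub-sub M Ss σ)) (≈sym (sub-sub N Ts σ)) (rule r (Ps [ σ ]ʳs))
    (P ⨾ Q)      [ σ ]ʳ = (P [ σ ]ʳ) ⨾ (Q [ σ ]ʳ)
    conv p q P   [ σ ]ʳ = conv (sub-cong p σ) (sub-cong q σ) (P [ σ ]ʳ)
    rvar x       [ σ ]ʳ = reflR (lookup σ x)
    runit        [ σ ]ʳ = runit
    rop c Ps     [ σ ]ʳ = rop c (Ps [ σ ]ʳs)
    rlam P       [ σ ]ʳ = rlam (P [ lift σ ]ʳ)
    rapp P Q     [ σ ]ʳ = rapp (P [ σ ]ʳ) (Q [ σ ]ʳ)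
    rpair P Q    [ σ ]ʳ = rpair (P [ σ ]ʳ) (Q [ σ ]ʳ)
    rfst P       [ σ ]ʳ = rfst (P [ σ ]ʳ)
    rsnd P       [ σ ]ʳ = rsnd (P [ σ ]ʳ)

    _[_]ʳs : {Ms Ns : Tms G Δ} → Reds G Δ Ms Ns → (σ : Tms Γ G) → Reds Γ Δ (subs Ms σ) (subs Ns σ)
    []       [ σ ]ʳs = []
    (P ∷ Ps) [ σ ]ʳs = (P [ σ ]ʳ) ∷ (Ps [ σ ]ʳs)

  renR : (ρ : Ren G Γ) {M N : Tm G A} → Red G A M N → Red Γ A (ren ρ M) (ren ρ N)
  renR ρ {M} {N} P = conv (≈sym (ren-sub ρ M)) (≈sym (ren-sub ρ N)) (P [ varsOf ρ ]ʳ)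

  renRs : (ρ : Ren G Γ) {Ms Ns : Tms G Δ} → Reds G Δ Ms Ns → Reds Γ Δ (rens ρ Ms) (rens ρ Ns)
  renRs ρ []       = []
  renRs ρ (P ∷ Ps) = renR ρ P ∷ renRs ρ Ps

  lookupR : {Ms Ns : Tms Γ G} → Reds Γ G Ms Ns → (x : G ∋ A) → Red Γ A (lookup Ms x) (lookup Ns x)
  lookupR (P ∷ Ps) here      = P
  lookupR (P ∷ Ps) (there x) = lookupR Ps x

  liftR : {Ms Ns : Tms Γ G} → Reds Γ G Ms Ns → Reds (A ∷ Γ) (A ∷ G) (lift Ms) (lift Ns)
  liftR Ps = rvar here ∷ renRs there Ps

  mutual
    _⟨_⟩ˡ : (M : Tm G A) {Ss Ts : Tms Γ G} → Reds Γ G Ss Ts → Red Γ A (sub M Ss) (sub M Ts)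
    var x    ⟨ Qs ⟩ˡ = lookupR Qs x
    unit     ⟨ Qs ⟩ˡ = runit
    pair M N ⟨ Qs ⟩ˡ = rpair (M ⟨ Qs ⟩ˡ) (N ⟨ Qs ⟩ˡ)
    fst M    ⟨ Qs ⟩ˡ = rfst (M ⟨ Qs ⟩ˡ)
    snd M    ⟨ Qs ⟩ˡ = rsnd (M ⟨ Qs ⟩ˡ)
    lam M    ⟨ Qs ⟩ˡ = rlam (M ⟨ liftR Qs ⟩ˡ)
    app M N  ⟨ Qs ⟩ˡ = rapp (M ⟨ Qs ⟩ˡ) (N ⟨ Qs ⟩ˡ)
    op c Ms  ⟨ Qs ⟩ˡ = rop c (Ms ⟨ Qs ⟩ˡs)

    _⟨_⟩ˡs : (Ms : Tms G Δ) {Ss Ts : Tms Γ G} → Reds Γ G Ss Ts → Reds Γ Δ (subs Ms Ss) (subs Ms Ts)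
    []       ⟨ Qs ⟩ˡs = []
    (M ∷ Ms) ⟨ Qs ⟩ˡs = (M ⟨ Qs ⟩ˡ) ∷ (Ms ⟨ Qs ⟩ˡs)

  _⟦_⟧ : {M M' : Tm G A} {Ns Ns' : Tms Γ G} → Red G A M M' → Reds Γ G Ns Ns' → Red Γ A (sub M Ns) (sub M' Ns')
  _⟦_⟧ {M' = M'} {Ns = Ns} P Qs = (P [ Ns ]ʳ) ⨾ (M' ⟨ Qs ⟩ˡ)

  ηR : {M N : Tm G A} → R G A M N → Red G A M N
  ηR {G = G} {M = M} {N} r = conv (sub-id M) (sub-id N) (rule r (reflRs (idTms G)))

module Permutation {S : Set} {Op : Arity S} (R : RuleFam S Op)
  (tr : ∀ {G A} {M M' N N' : Syntax.Tm Op G A} →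
        Syntax._≈_ Op M M' → Syntax._≈_ Op N N' → R G A M N → R G A M' N') where

  open Syntax Op
  open Reductions R

  private variable
    A B : Ty S
    Γ Δ G : Ctx S

  infix 4 _≅_ _≅s_

  mutual
    data _≅_ : {Γ : Ctx S} {A : Ty S} {M N M' N' : Tm Γ A} → Red Γ A M N → Red Γ A M' N' → Set where
      ≅refl  : ∀ {M N} {P : Red Γ A M N} → P ≅ P
      ≅sym   : ∀ {M N M' N'} {P : Red Γ A M N} {Q : Red Γ A M' N'} → P ≅ Q → Q ≅ P
      ≅trans : ∀ {M N M' N' M'' N''} {P : Red Γ A M N} {Q : Red Γ A M' N'} {U : Red Γ A M'' N''} →
               P ≅ Q → Q ≅ U → P ≅ U
      rule-cong : ∀ {M N : Tm G A} (r : R G A M N) {Ss Ts Ss' Ts' : Tms Γ G}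
                  {Ps : Reds Γ G Ss Ts} {Qs : Reds Γ G Ss' Ts'} → Ps ≅s Qs → rule r Ps ≅ rule r Qs
      rule-tr   : ∀ {M M' N N' : Tm G A} (p : M ≈ M') (q : N ≈ N') (r : R G A M N)
                  {Ss Ts : Tms Γ G} (Ps : Reds Γ G Ss Ts) → rule (tr p q r) Ps ≅ rule r Ps
      ⨾-cong    : ∀ {M₁ M₂ M₃ N₁ N₂ N₃} {P : Red Γ A M₁ M₂} {Q : Red Γ A M₂ M₃}
                  {P' : Red Γ A N₁ N₂} {Q' : Red Γ A N₂ N₃} → P ≅ P' → Q ≅ Q' → (P ⨾ Q) ≅ (P' ⨾ Q')
      conv-elim : ∀ {M M' N N'} (p : M ≈ M') (q : N ≈ N') (P : Red Γ A M N) → conv p q P ≅ P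
      rop-cong  : (c : Op Δ B) {Ms Ns Ms' Ns' : Tms Γ Δ} {Ps : Reds Γ Δ Ms Ns} {Qs : Reds Γ Δ Ms' Ns'} →
                  Ps ≅s Qs → rop c Ps ≅ rop c Qs
      rlam-cong : ∀ {M N M' N'} {P : Red (A ∷ Γ) B M N} {Q : Red (A ∷ Γ) B M' N'} → P ≅ Q → rlam P ≅ rlam Q
      rapp-cong : ∀ {M N M' N' K L K' L'} {P : Red Γ (A ⇒ B) M N} {P' : Red Γ (A ⇒ B) M' N'}
                  {Q : Red Γ A K L} {Q' : Red Γ A K' L'} → P ≅ P' → Q ≅ Q' → rapp P Q ≅ rapp P' Q'
      rpair-cong : ∀ {M N M' N' K L K' L'} {P : Red Γ A M N} {P' : Red Γ A M' N'}
                  {Q : Red Γ B K L} {Q' : Red Γ B K' L'} → P ≅ P' → Q ≅ Q' → rpair P Q ≅ rpair P' Q'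
      rfst-cong : ∀ {M N M' N'} {P : Red Γ (A ⊗ B) M N} {Q : Red Γ (A ⊗ B) M' N'} → P ≅ Q → rfst P ≅ rfst Q
      rsnd-cong : ∀ {M N M' N'} {P : Red Γ (A ⊗ B) M N} {Q : Red Γ (A ⊗ B) M' N'} → P ≅ Q → rsnd P ≅ rsnd Q
      ⨾-assoc : ∀ {M₁ M₂ M₃ M₄} (P : Red Γ A M₁ M₂) (Q : Red Γ A M₂ M₃) (U : Red Γ A M₃ M₄) →
                ((P ⨾ Q) ⨾ U) ≅ (P ⨾ (Q ⨾ U))
      ⨾-unitˡ : ∀ {M N} (P : Red Γ A M N) → (reflR M ⨾ P) ≅ P
      ⨾-unitʳ : ∀ {M N} (P : Red Γ A M N) → (P ⨾ reflR N) ≅ P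
      β-lam  : ∀ {M N K L} (P : Red (A ∷ Γ) B M N) (Q : Red Γ A K L) →
               rapp (rlam P) Q ≅ (P ⟦ Q ∷ reflRs (idTms Γ) ⟧)
      η-lam  : ∀ {M N} (P : Red Γ (A ⇒ B) M N) → P ≅ rlam (rapp (renR there P) (rvar here))
      β-fst  : ∀ {M N K L} (P : Red Γ A M N) (Q : Red Γ B K L) → rfst (rpair P Q) ≅ P
      β-snd  : ∀ {M N K L} (P : Red Γ A M N) (Q : Red Γ B K L) → rsnd (rpair P Q) ≅ Q
      η-pair : ∀ {M N} (P : Red Γ (A ⊗ B) M N) → P ≅ rpair (rfst P) (rsnd P)
      η-unit : ∀ {M N} (P : Red Γ 𝟙 M N) → P ≅ runit
      rule-⨾ˡ : ∀ {M₁ M₂ : Tm G A} (r : R G A M₁ M₂) {Ss Us Ts : Tms Γ G}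
                (Ps : Reds Γ G Ss Us) (Qs : Reds Γ G Us Ts) →
                rule r (compRs Ps Qs) ≅ ((M₁ ⟨ Ps ⟩ˡ) ⨾ rule r Qs)
      rule-⨾ʳ : ∀ {M₁ M₂ : Tm G A} (r : R G A M₁ M₂) {Ss Us Ts : Tms Γ G}
                (Ps : Reds Γ G Ss Us) (Qs : Reds Γ G Us Ts) →
                rule r (compRs Ps Qs) ≅ (rule r Ps ⨾ (M₂ ⟨ Qs ⟩ˡ))
      rop-⨾   : (c : Op Δ B) {Ms Ns Ks : Tms Γ Δ} (Ps : Reds Γ Δ Ms Ns) (Qs : Reds Γ Δ Ns Ks) →
                rop c (compRs Ps Qs) ≅ (rop c Ps ⨾ rop c Qs)
      rlam-⨾  : ∀ {M₁ M₂ M₃} (P : Red (A ∷ Γ) B M₁ M₂) (Q : Red (A ∷ Γ) B M₂ M₃) →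
                rlam (P ⨾ Q) ≅ (rlam P ⨾ rlam Q)
      rapp-⨾  : ∀ {M₁ M₂ M₃ K₁ K₂ K₃} (P : Red Γ (A ⇒ B) M₁ M₂) (Q : Red Γ (A ⇒ B) M₂ M₃)
                (P' : Red Γ A K₁ K₂) (Q' : Red Γ A K₂ K₃) →
                rapp (P ⨾ Q) (P' ⨾ Q') ≅ (rapp P P' ⨾ rapp Q Q')
      rpair-⨾ : ∀ {M₁ M₂ M₃ K₁ K₂ K₃} (P : Red Γ A M₁ M₂) (Q : Red Γ A M₂ M₃)
                (P' : Red Γ B K₁ K₂) (Q' : Red Γ B K₂ K₃) →
                rpair (P ⨾ Q) (P' ⨾ Q') ≅ (rpair P P' ⨾ rpair Q Q')
      rfst-⨾  : ∀ {M₁ M₂ M₃} (P : Red Γ (A ⊗ B) M₁ M₂) (Q : Red Γ (A ⊗ B) M₂ M₃) →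
                rfst (P ⨾ Q) ≅ (rfst P ⨾ rfst Q)
      rsnd-⨾  : ∀ {M₁ M₂ M₃} (P : Red Γ (A ⊗ B) M₁ M₂) (Q : Red Γ (A ⊗ B) M₂ M₃) →
                rsnd (P ⨾ Q) ≅ (rsnd P ⨾ rsnd Q)

    data _≅s_ : {Γ G : Ctx S} {Ms Ns Ms' Ns' : Tms Γ G} → Reds Γ G Ms Ns → Reds Γ G Ms' Ns' → Set where
      []  : _≅s_ {Γ} [] []
      _∷_ : ∀ {M N M' N' : Tm Γ A} {Ms Ns Ms' Ns' : Tms Γ G}
            {P : Red Γ A M N} {Q : Red Γ A M' N'} {Ps : Reds Γ G Ms Ns} {Qs : Reds Γ G Ms' Ns'} →
            P ≅ Q → Ps ≅s Qs → (P ∷ Ps) ≅s (Q ∷ Qs)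

module LMap {S : Set} {Op : Arity S} {R₁ R₂ : RuleFam S Op}
  (f : ∀ {G A M N} → R₁ G A M N → R₂ G A M N) where

  open Syntax Op
  private
    module R₁ = Reductions R₁
    module R₂ = Reductions R₂

  mutual
    Lmap : ∀ {Γ A M N} → R₁.Red Γ A M N → R₂.Red Γ A M N
    Lmap (R₁.rule r Ps)  = R₂.rule (f r) (Lmaps Ps)
    Lmap (P R₁.⨾ Q)      = Lmap P R₂.⨾ Lmap Q
    Lmap (R₁.conv p q P) = R₂.conv p q (Lmap P)
    Lmap (R₁.rvar x)     = R₂.rvar x
    Lmap R₁.runit        = R₂.runit
    Lmap (R₁.rop c Ps)   = R₂.rop c (Lmaps Ps)
    Lmap (R₁.rlam P)     = R₂.rlam (Lmap P)
    Lmap (R₁.rapp P Q)   = R₂.rapp (Lmap P) (Lmap Q)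
    Lmap (R₁.rpair P Q)  = R₂.rpair (Lmap P) (Lmap Q)
    Lmap (R₁.rfst P)     = R₂.rfst (Lmap P)
    Lmap (R₁.rsnd P)     = R₂.rsnd (Lmap P)

    Lmaps : ∀ {Γ G Ms Ns} → R₁.Reds Γ G Ms Ns → R₂.Reds Γ G Ms Ns
    Lmaps R₁.[]       = R₂.[]
    Lmaps (P R₁.∷ Ps) = Lmap P R₂.∷ Lmaps Ps

-- The multiplication μ : 𝓛𝓛X → 𝓛X  (on representatives)
-- rules of 𝓛X over (G ⊢ M,N) are (representatives of) reductions M → N

module Mult {S : Set} {Op : Arity S} (R : RuleFam S Op) where

  open Syntax Op
  private
    module R₁ = Reductions R
    module R₂ = Reductions R₁.Red

  mutual
    μ : ∀ {Γ A M N} → R₂.Red Γ A M N → R₁.Red Γ A M N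
    μ (R₂.rule P Ps)    = P R₁.⟦ μs Ps ⟧
    μ (P R₂.⨾ Q)        = μ P R₁.⨾ μ Q
    μ (R₂.conv p q P)   = R₁.conv p q (μ P)
    μ (R₂.rvar x)       = R₁.rvar x
    μ R₂.runit          = R₁.runit
    μ (R₂.rop c Ps)     = R₁.rop c (μs Ps)
    μ (R₂.rlam P)       = R₁.rlam (μ P)
    μ (R₂.rapp P Q)     = R₁.rapp (μ P) (μ Q)
    μ (R₂.rpair P Q)    = R₁.rpair (μ P) (μ Q)
    μ (R₂.rfst P)       = R₁.rfst (μ P)
    μ (R₂.rsnd P)       = R₁.rsnd (μ P)

    μs : ∀ {Γ G Ms Ns} → R₂.Reds Γ G Ms Ns → R₁.Reds Γ G Ms Ns
    μs R₂.[]       = R₁.[]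
    μs (P R₂.∷ Ps) = μ P R₁.∷ μs Ps

module _ (X : Sig₂) where

  open Sig₂ X
  open Syntax Op
  open Reductions Rule
  open Permutation Rule tr
  open LMap {R₁ = Reductions.Red Rule} {R₂ = Rule}
  open Mult Rule

  -- Since h ∘ η = id and η is the
  -- identity on sorts and operations, h is the identity on sorts and
  -- operations; its rule part is a map on ≅-classes of reductions, given here
  -- as a map on representatives respecting ≅ (and βη-transport).
  record IsAlgebra (h : ∀ {G A M N} → Red G A M N → Rule G A M N) : Set where
    field
      h-resp : ∀ {G A} {M N M' N' : Tm G A} {P : Red G A M N} {Q : Red G A M' N'} →
               P ≅ Q → (p : M ≈ M') (q : N ≈ N') → tr p q (h P) ≡ h Q
      h-unit : ∀ {G A} {M N : Tm G A} (r : Rule G A M N) → h (ηR r) ≡ r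
      h-mult : ∀ {G A} {M N : Tm G A} (Φ : Reductions.Red Red G A M N) →
               h (Lmap h Φ) ≡ h (μ Φ)

-- Strict 2-categories whose 1-cells form setoids (1-cells are given by
-- representatives, equality of 1-cells is _≈₁_, and 2-cells form a family
-- over the classes of 1-cells, via the coherent transport trc).

record TwoCatData : Set₁ where
  infix 4 _≈₁_
  infixr 9 _∘₁_
  infixl 5 _·_
  infixl 6 _*_
  field
    Obj  : Set
    Hom  : Obj → Obj → Set
    _≈₁_ : ∀ {a b} → Hom a b → Hom a b → Set
    Cell : ∀ {a b} → Hom a b → Hom a b → Set
    trc  : ∀ {a b} {f f' g g' : Hom a b} → f ≈₁ f' → g ≈₁ g' → Cell f g → Cell f' g'
    id₁  : ∀ {a} → Hom a a
    _∘₁_ : ∀ {a b c} → Hom b c → Hom a b → Hom a c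
    id₂  : ∀ {a b} (f : Hom a b) → Cell f f
    -- vertical composition (diagrammatic order)
    _·_  : ∀ {a b} {f g k : Hom a b} → Cell f g → Cell g k → Cell f k
    _*_  : ∀ {a b c} {f f' : Hom a b} {g g' : Hom b c} →
           Cell f f' → Cell g g' → Cell (g ∘₁ f) (g' ∘₁ f')

record Is2Category (𝒞 : TwoCatData) : Set where
  open TwoCatData 𝒞
  field
    ≈₁-refl  : ∀ {a b} {f : Hom a b} → f ≈₁ f
    ≈₁-sym   : ∀ {a b} {f g : Hom a b} → f ≈₁ g → g ≈₁ f
    ≈₁-trans : ∀ {a b} {f g k : Hom a b} → f ≈₁ g → g ≈₁ k → f ≈₁ k
    trc-id   : ∀ {a b} {f g : Hom a b} (p : f ≈₁ f) (q : g ≈₁ g) (α : Cell f g) → trc p q α ≡ α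
    trc-trc  : ∀ {a b} {f f' f'' g g' g'' : Hom a b}
               (p : f ≈₁ f') (q : g ≈₁ g') (p' : f' ≈₁ f'') (q' : g' ≈₁ g'')
               (p'' : f ≈₁ f'') (q'' : g ≈₁ g'') (α : Cell f g) →
               trc p' q' (trc p q α) ≡ trc p'' q'' α
    ∘₁-cong  : ∀ {a b c} {f f' : Hom a b} {g g' : Hom b c} → f ≈₁ f' → g ≈₁ g' → g ∘₁ f ≈₁ g' ∘₁ f'
    id₂-trc  : ∀ {a b} {f f' : Hom a b} (p q : f ≈₁ f') → trc p q (id₂ f) ≡ id₂ f'
    ·-trc    : ∀ {a b} {f f' g g' k k' : Hom a b} (p : f ≈₁ f') (q : g ≈₁ g') (r : k ≈₁ k')
               (α : Cell f g) (β : Cell g k) → trc p r (α · β) ≡ trc p q α · trc q r β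
    *-trc    : ∀ {a b c} {f₁ f₁' f₂ f₂' : Hom a b} {g₁ g₁' g₂ g₂' : Hom b c}
               (p : f₁ ≈₁ f₁') (p' : f₂ ≈₁ f₂') (q : g₁ ≈₁ g₁') (q' : g₂ ≈₁ g₂')
               (u : g₁ ∘₁ f₁ ≈₁ g₁' ∘₁ f₁') (u' : g₂ ∘₁ f₂ ≈₁ g₂' ∘₁ f₂')
               (α : Cell f₁ f₂) (β : Cell g₁ g₂) → trc u u' (α * β) ≡ trc p p' α * trc q q' β
    ∘₁-assoc : ∀ {a b c d} (f : Hom a b) (g : Hom b c) (k : Hom c d) → (k ∘₁ g) ∘₁ f ≈₁ k ∘₁ (g ∘₁ f)
    ∘₁-idˡ   : ∀ {a b} (f : Hom a b) → id₁ ∘₁ f ≈₁ f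
    ∘₁-idʳ   : ∀ {a b} (f : Hom a b) → f ∘₁ id₁ ≈₁ f
    ·-assoc  : ∀ {a b} {f g k l : Hom a b} (α : Cell f g) (β : Cell g k) (γ : Cell k l) →
               (α · β) · γ ≡ α · (β · γ)
    ·-idˡ    : ∀ {a b} {f g : Hom a b} (α : Cell f g) → id₂ f · α ≡ α
    ·-idʳ    : ∀ {a b} {f g : Hom a b} (α : Cell f g) → α · id₂ g ≡ α
    interchange : ∀ {a b c} {f₁ f₂ f₃ : Hom a b} {g₁ g₂ g₃ : Hom b c}
                  (α : Cell f₁ f₂) (α' : Cell f₂ f₃) (β : Cell g₁ g₂) (β' : Cell g₂ g₃) →
                  (α · α') * (β · β') ≡ (α * β) · (α' * β')
    *-id₂    : ∀ {a b c} (f : Hom a b) (g : Hom b c) → id₂ f * id₂ g ≡ id₂ (g ∘₁ f)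
    *-assoc  : ∀ {a b c d} {f f' : Hom a b} {g g' : Hom b c} {k k' : Hom c d}
               (u : (k ∘₁ g) ∘₁ f ≈₁ k ∘₁ (g ∘₁ f)) (u' : (k' ∘₁ g') ∘₁ f' ≈₁ k' ∘₁ (g' ∘₁ f'))
               (α : Cell f f') (β : Cell g g') (γ : Cell k k') →
               trc u u' (α * (β * γ)) ≡ (α * β) * γ
    *-idˡ    : ∀ {a b} {f f' : Hom a b} (u : id₁ ∘₁ f ≈₁ f) (u' : id₁ ∘₁ f' ≈₁ f') (α : Cell f f') →
               trc u u' (α * id₂ id₁) ≡ α
    *-idʳ    : ∀ {a b} {f f' : Hom a b} (u : f ∘₁ id₁ ≈₁ f) (u' : f' ∘₁ id₁ ≈₁ f') (α : Cell f f') →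
               trc u u' (id₂ id₁ * α) ≡ α

record IsIsoFunctor {O₁ O₂ : Set}
  (_≈O₁_ : O₁ → O₁ → Set) (_≈O₂_ : O₂ → O₂ → Set)
  (M₁ : O₁ → O₁ → Set) (M₂ : O₂ → O₂ → Set)
  (F₀ : O₁ → O₂) (F₁ : ∀ {x y} → M₁ x y → M₂ (F₀ x) (F₀ y)) : Set where
  field
    ob-inj   : ∀ x y → F₀ x ≈O₂ F₀ y → x ≈O₁ y
    ob-surj  : ∀ y → Σ O₁ (λ x → F₀ x ≈O₂ y)
    hom-inj  : ∀ {x y} (α β : M₁ x y) → F₁ α ≡ F₁ β → α ≡ β
    hom-surj : ∀ {x y} (β : M₂ (F₀ x) (F₀ y)) → Σ (M₁ x y) (λ α → F₁ α ≡ β)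

-- Cartesian closed 2-categories, with prescribed terminal object, binary
-- products (on objects) and exponentials (exp a b = b^a)

record CartesianClosed (𝒞 : TwoCatData)
  (⊤ₒ : TwoCatData.Obj 𝒞)
  (_×ₒ_ : TwoCatData.Obj 𝒞 → TwoCatData.Obj 𝒞 → TwoCatData.Obj 𝒞)
  (exp : TwoCatData.Obj 𝒞 → TwoCatData.Obj 𝒞 → TwoCatData.Obj 𝒞) : Set where
  open TwoCatData 𝒞
  field
    _⊗₁_   : ∀ {a a' b b'} → Hom a a' → Hom b b' → Hom (a ×ₒ b) (a' ×ₒ b')
    _⊗₂_   : ∀ {a a' b b'} {f f' : Hom a a'} {g g' : Hom b b'} →
             Cell f f' → Cell g g' → Cell (f ⊗₁ g) (f' ⊗₁ g')
    ⊗₁-cong : ∀ {a a' b b'} {f f' : Hom a a'} {g g' : Hom b b'} → f ≈₁ f' → g ≈₁ g' → f ⊗₁ g ≈₁ f' ⊗₁ g'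
    ⊗₂-trc  : ∀ {a a' b b'} {f₁ f₁' f₂ f₂' : Hom a a'} {g₁ g₁' g₂ g₂' : Hom b b'}
              (p : f₁ ≈₁ f₁') (p' : f₂ ≈₁ f₂') (q : g₁ ≈₁ g₁') (q' : g₂ ≈₁ g₂')
              (u : f₁ ⊗₁ g₁ ≈₁ f₁' ⊗₁ g₁') (u' : f₂ ⊗₁ g₂ ≈₁ f₂' ⊗₁ g₂')
              (α : Cell f₁ f₂) (β : Cell g₁ g₂) → trc u u' (α ⊗₂ β) ≡ trc p p' α ⊗₂ trc q q' β
    ⊗₁-id   : ∀ {a b} → id₁ {a} ⊗₁ id₁ {b} ≈₁ id₁
    ⊗₁-∘    : ∀ {a a' a'' b b' b''} (f : Hom a a') (f' : Hom a' a'') (g : Hom b b') (g' : Hom b' b'') →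
              (f' ∘₁ f) ⊗₁ (g' ∘₁ g) ≈₁ (f' ⊗₁ g') ∘₁ (f ⊗₁ g)
    ⊗₂-id   : ∀ {a a' b b'} (f : Hom a a') (g : Hom b b') → id₂ f ⊗₂ id₂ g ≡ id₂ (f ⊗₁ g)
    ⊗₂-·    : ∀ {a a' b b'} {f₁ f₂ f₃ : Hom a a'} {g₁ g₂ g₃ : Hom b b'}
              (α : Cell f₁ f₂) (α' : Cell f₂ f₃) (β : Cell g₁ g₂) (β' : Cell g₂ g₃) →
              (α · α') ⊗₂ (β · β') ≡ (α ⊗₂ β) · (α' ⊗₂ β')
    ⊗₂-*    : ∀ {a a' a'' b b' b''} {f₁ f₂ : Hom a a'} {f₁' f₂' : Hom a' a''}
              {g₁ g₂ : Hom b b'} {g₁' g₂' : Hom b' b''}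
              (u : (f₁' ∘₁ f₁) ⊗₁ (g₁' ∘₁ g₁) ≈₁ (f₁' ⊗₁ g₁') ∘₁ (f₁ ⊗₁ g₁))
              (u' : (f₂' ∘₁ f₂) ⊗₁ (g₂' ∘₁ g₂) ≈₁ (f₂' ⊗₁ g₂') ∘₁ (f₂ ⊗₁ g₂))
              (α : Cell f₁ f₂) (α' : Cell f₁' f₂') (β : Cell g₁ g₂) (β' : Cell g₁' g₂') →
              trc u u' ((α * α') ⊗₂ (β * β')) ≡ (α ⊗₂ β) * (α' ⊗₂ β')
    π₁ : ∀ {a b} → Hom (a ×ₒ b) a
    π₂ : ∀ {a b} → Hom (a ×ₒ b) b
    ev : ∀ {a b} → Hom (a ×ₒ exp a b) b
    terminal : ∀ d → IsIsoFunctor {Hom d ⊤ₒ} {⊤} _≈₁_ (λ _ _ → ⊤) Cell (λ _ _ → ⊤)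
                                  (λ _ → tt) (λ _ → tt)
    product  : ∀ d a b → IsIsoFunctor {Hom d (a ×ₒ b)} {Hom d a × Hom d b}
                 _≈₁_ (λ { (f , g) (f' , g') → (f ≈₁ f') × (g ≈₁ g') })
                 Cell (λ { (f , g) (f' , g') → Cell f f' × Cell g g' })
                 (λ f → (π₁ ∘₁ f , π₂ ∘₁ f))
                 (λ α → (α * id₂ π₁ , α * id₂ π₂))
    exponential : ∀ d a b → IsIsoFunctor {Hom d (exp a b)} {Hom (a ×ₒ d) b}
                 _≈₁_ _≈₁_ Cell Cell
                 (λ f → ev ∘₁ (id₁ ⊗₁ f))
                 (λ α → (id₂ id₁ ⊗₂ α) * id₂ ev)

module _ (X : Sig₂) where

  open Sig₂ X
  open Syntax Op
  open Reductions Rule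

  𝓕 : (∀ {G A M N} → Red G A M N → Rule G A M N) → TwoCatData
  𝓕 h = record
    { Obj  = Ty Sort
    ; Hom  = λ A B → Tm (A ∷ []) B
    ; _≈₁_ = _≈_
    ; Cell = λ {A} {B} M N → Rule (A ∷ []) B M N
    ; trc  = tr
    ; id₁  = var here
    ; _∘₁_ = λ N M → sub N (M ∷ [])
    ; id₂  = λ M → h (reflR M)
    ; _·_  = λ α β → h (ηR α ⨾ ηR β)
    ; _*_  = λ α β → h (rule β (ηR α ∷ []))
    }

module Submission where

-- Every 2-cell operation of 𝓕(X,h) has the form h(P) for a reduction P built
-- from units η(α) of 2-cells.  The one tool for proving equations between
-- such 2-cells is *coherence*: if a reduction Φ of 𝓛𝓛X satisfies
-- 𝓛h(Φ) ≅ P and μ(Φ) ≅ Q, then h(P) = h(Q), by the multiplication law of the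
-- algebra and the fact that h is defined on ≅-classes.  Computing μ(Φ)
-- requires the calculus of substitution of reductions (right/left
-- whiskering), which we develop for the structural part _~_ of permutation
-- equivalence: unlike _≅_ itself, it is easily seen to be stable under right
-- whiskering.

open import Defs
open import Data.Product.Base using (Σ; _,_; _×_; proj₁; proj₂)
open import Data.List.Base using ([]; _∷_)
open import Data.Unit.Base using (tt)
open import Relation.Binary.PropositionalEquality using (_≡_; refl; sym; trans; cong; cong₂; subst)

module SubstitutionLemmas {S : Set} (Op : Arity S) where

  open Syntax Op

  private variable
    A B : Ty S
    Γ Δ G : Ctx S

  ≡⇒≈ : {M N : Tm Γ A} → M ≡ N → M ≈ N
  ≡⇒≈ refl = ≈refl

  lookup-cong : {σ σ' : Tms Γ G} → σ ≈s σ' → (x : G ∋ A) → lookup σ x ≈ lookup σ' x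
  lookup-cong (e ∷ es) here      = e
  lookup-cong (e ∷ es) (there x) = lookup-cong es x

  ren-cong : (ρ : Ren G Γ) {M M' : Tm G A} → M ≈ M' → ren ρ M ≈ ren ρ M'
  ren-cong ρ {M} {M'} e = ≈trans (ren-sub ρ M) (≈trans (sub-cong e _) (≈sym (ren-sub ρ M')))

  rens-cong : (ρ : Ren G Γ) {σ σ' : Tms G Δ} → σ ≈s σ' → rens ρ σ ≈s rens ρ σ'
  rens-cong ρ []       = []
  rens-cong ρ (e ∷ es) = ren-cong ρ e ∷ rens-cong ρ es

  lift-cong : {σ σ' : Tms Γ G} → σ ≈s σ' → lift {A = A} σ ≈s lift σ'
  lift-cong e = ≈refl ∷ rens-cong there e

  mutual
    sub-congʳ : (M : Tm G A) {σ σ' : Tms Γ G} → σ ≈s σ' → sub M σ ≈ sub M σ'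
    sub-congʳ (var x)    e = lookup-cong e x
    sub-congʳ unit       e = ≈refl
    sub-congʳ (pair M N) e = pair-cong (sub-congʳ M e) (sub-congʳ N e)
    sub-congʳ (fst M)    e = fst-cong (sub-congʳ M e)
    sub-congʳ (snd M)    e = snd-cong (sub-congʳ M e)
    sub-congʳ (lam M)    e = lam-cong (sub-congʳ M (lift-cong e))
    sub-congʳ (app M N)  e = app-cong (sub-congʳ M e) (sub-congʳ N e)
    sub-congʳ (op c Ms)  e = op-cong c (subs-congʳ Ms e)

    subs-congʳ : (Ms : Tms G Δ) {σ σ' : Tms Γ G} → σ ≈s σ' → subs Ms σ ≈s subs Ms σ'
    subs-congʳ []       e = []
    subs-congʳ (M ∷ Ms) e = sub-congʳ M e ∷ subs-congʳ Ms e

  lookup-subs : (σ : Tms Δ G) (τ : Tms Γ Δ) (x : G ∋ A) → lookup (subs σ τ) x ≡ sub (lookup σ x) τ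
  lookup-subs (M ∷ σ) τ here      = refl
  lookup-subs (M ∷ σ) τ (there x) = lookup-subs σ τ x

  lookup-rens : (ρ : Ren Δ Γ) (σ : Tms Δ G) (x : G ∋ A) → lookup (rens ρ σ) x ≡ ren ρ (lookup σ x)
  lookup-rens ρ (M ∷ σ) here      = refl
  lookup-rens ρ (M ∷ σ) (there x) = lookup-rens ρ σ x

  lookup-varsOf : (ρ : Ren Γ Δ) (x : Γ ∋ A) → lookup (varsOf ρ) x ≡ var (ρ x)
  lookup-varsOf ρ here      = refl
  lookup-varsOf ρ (there x) = lookup-varsOf (λ y → ρ (there y)) x

  pointwise : {σ σ' : Tms Γ G} → (∀ {A} (x : G ∋ A) → lookup σ x ≈ lookup σ' x) → σ ≈s σ'
  pointwise {σ = []}    {[]}      f = []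
  pointwise {σ = M ∷ σ} {M' ∷ σ'} f = f here ∷ pointwise (λ x → f (there x))

  weaken-lift : (τ : Tms Γ Δ) → subs (varsOf (there {B = A})) (lift τ) ≈s subs τ (varsOf (there {B = A}))
  weaken-lift τ = pointwise λ x →
    ≈trans (≡⇒≈ (lookup-subs (varsOf there) (lift τ) x))
    (≈trans (≡⇒≈ (cong (λ u → sub u (lift τ)) (lookup-varsOf there x)))
    (≈trans (≡⇒≈ (lookup-rens there τ x))
    (≈trans (ren-sub there (lookup τ x))
    (≡⇒≈ (sym (lookup-subs τ (varsOf there) x))))))

  weaken-sub-lift : (M : Tm Δ B) (τ : Tms Γ Δ) → sub (ren (there {B = A}) M) (lift τ) ≈ ren there (sub M τ)
  weaken-sub-lift M τ =
    ≈trans (sub-cong (ren-sub there M) (lift τ))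
    (≈trans (sub-sub M (varsOf there) (lift τ))
    (≈trans (sub-congʳ M (weaken-lift τ))
    (≈trans (≈sym (sub-sub M τ (varsOf there)))
    (≈sym (ren-sub there (sub M τ))))))

  lift-subs : (σ : Tms Δ G) (τ : Tms Γ Δ) → subs (lift {A = A} σ) (lift τ) ≈s lift (subs σ τ)
  lift-subs σ τ = ≈refl ∷ pointwise λ x →
    ≈trans (≡⇒≈ (lookup-subs (rens there σ) (lift τ) x))
    (≈trans (≡⇒≈ (cong (λ u → sub u (lift τ)) (lookup-rens there σ x)))
    (≈trans (weaken-sub-lift (lookup σ x) τ)
    (≈trans (≡⇒≈ (cong (ren there) (sym (lookup-subs σ τ x))))
    (≡⇒≈ (sym (lookup-rens there (subs σ τ) x))))))

module StructuralEquivalence {S : Set} {Op : Arity S} (R : RuleFam S Op)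
  (tr : ∀ {G A} {M M' N N' : Syntax.Tm Op G A} →
        Syntax._≈_ Op M M' → Syntax._≈_ Op N N' → R G A M N → R G A M' N') where

  open Syntax Op
  open Reductions R
  open Permutation R tr
  open SubstitutionLemmas Op

  private variable
    A B : Ty S
    Γ Δ G Θ : Ctx S

  -- Unlike _≅_ it is stable under right
  -- whiskering (~-subʳ), which is what the substitution calculus needs.
  infix 4 _~_ _~s_
  mutual
    data _~_ : ∀ {Γ A} {M N M' N' : Tm Γ A} → Red Γ A M N → Red Γ A M' N' → Set where
      ~refl  : ∀ {M N} {P : Red Γ A M N} → P ~ P
      ~sym   : ∀ {M N M' N'} {P : Red Γ A M N} {Q : Red Γ A M' N'} → P ~ Q → Q ~ P
      ~trans : ∀ {M N M' N' M'' N''} {P : Red Γ A M N} {Q : Red Γ A M' N'} {U : Red Γ A M'' N''} →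
               P ~ Q → Q ~ U → P ~ U
      ~conv  : ∀ {M M' N N'} (p : M ≈ M') (q : N ≈ N') (P : Red Γ A M N) → conv p q P ~ P
      ~rule  : ∀ {M N : Tm G A} (r : R G A M N) {Ss Ts Ss' Ts' : Tms Γ G}
               {Ps : Reds Γ G Ss Ts} {Qs : Reds Γ G Ss' Ts'} → Ps ~s Qs → rule r Ps ~ rule r Qs
      ~rule-tr : ∀ {M M' N N' : Tm G A} (p : M ≈ M') (q : N ≈ N') (r : R G A M N)
               {Ss Ts : Tms Γ G} (Ps : Reds Γ G Ss Ts) → rule (tr p q r) Ps ~ rule r Ps
      ~⨾     : ∀ {M₁ M₂ M₃ N₁ N₂ N₃} {P : Red Γ A M₁ M₂} {Q : Red Γ A M₂ M₃}
               {P' : Red Γ A N₁ N₂} {Q' : Red Γ A N₂ N₃} → P ~ P' → Q ~ Q' → (P ⨾ Q) ~ (P' ⨾ Q')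
      ~rop   : (c : Op Δ B) {Ms Ns Ms' Ns' : Tms Γ Δ} {Ps : Reds Γ Δ Ms Ns} {Qs : Reds Γ Δ Ms' Ns'} →
               Ps ~s Qs → rop c Ps ~ rop c Qs
      ~rlam  : ∀ {M N M' N'} {P : Red (A ∷ Γ) B M N} {Q : Red (A ∷ Γ) B M' N'} → P ~ Q → rlam P ~ rlam Q
      ~rapp  : ∀ {M N M' N' K L K' L'} {P : Red Γ (A ⇒ B) M N} {P' : Red Γ (A ⇒ B) M' N'}
               {Q : Red Γ A K L} {Q' : Red Γ A K' L'} → P ~ P' → Q ~ Q' → rapp P Q ~ rapp P' Q'
      ~rpair : ∀ {M N M' N' K L K' L'} {P : Red Γ A M N} {P' : Red Γ A M' N'}
               {Q : Red Γ B K L} {Q' : Red Γ B K' L'} → P ~ P' → Q ~ Q' → rpair P Q ~ rpair P' Q'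
      ~rfst  : ∀ {M N M' N'} {P : Red Γ (A ⊗ B) M N} {Q : Red Γ (A ⊗ B) M' N'} → P ~ Q → rfst P ~ rfst Q
      ~rsnd  : ∀ {M N M' N'} {P : Red Γ (A ⊗ B) M N} {Q : Red Γ (A ⊗ B) M' N'} → P ~ Q → rsnd P ~ rsnd Q
      ~unitˡ : ∀ {M N} (P : Red Γ A M N) → (reflR M ⨾ P) ~ P
      ~unitʳ : ∀ {M N} (P : Red Γ A M N) → (P ⨾ reflR N) ~ P

    data _~s_ : ∀ {Γ G} {Ms Ns Ms' Ns' : Tms Γ G} → Reds Γ G Ms Ns → Reds Γ G Ms' Ns' → Set where
      []  : _~s_ {Γ} [] []
      _∷_ : ∀ {M N M' N' : Tm Γ A} {Ms Ns Ms' Ns' : Tms Γ G}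
            {P : Red Γ A M N} {Q : Red Γ A M' N'} {Ps : Reds Γ G Ms Ns} {Qs : Reds Γ G Ms' Ns'} →
            P ~ Q → Ps ~s Qs → (P ∷ Ps) ~s (Q ∷ Qs)

  mutual
    ~⇒≅ : ∀ {M N M' N' : Tm Γ A} {P : Red Γ A M N} {Q : Red Γ A M' N'} → P ~ Q → P ≅ Q
    ~⇒≅ ~refl               = ≅refl
    ~⇒≅ (~sym e)            = ≅sym (~⇒≅ e)
    ~⇒≅ (~trans e e')       = ≅trans (~⇒≅ e) (~⇒≅ e')
    ~⇒≅ (~conv p q P)       = conv-elim p q P
    ~⇒≅ (~rule r es)        = rule-cong r (~s⇒≅s es)
    ~⇒≅ (~rule-tr p q r Ps) = rule-tr p q r Ps
    ~⇒≅ (~⨾ e e')           = ⨾-cong (~⇒≅ e) (~⇒≅ e')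
    ~⇒≅ (~rop c es)         = rop-cong c (~s⇒≅s es)
    ~⇒≅ (~rlam e)           = rlam-cong (~⇒≅ e)
    ~⇒≅ (~rapp e e')        = rapp-cong (~⇒≅ e) (~⇒≅ e')
    ~⇒≅ (~rpair e e')       = rpair-cong (~⇒≅ e) (~⇒≅ e')
    ~⇒≅ (~rfst e)           = rfst-cong (~⇒≅ e)
    ~⇒≅ (~rsnd e)           = rsnd-cong (~⇒≅ e)
    ~⇒≅ (~unitˡ P)          = ⨾-unitˡ P
    ~⇒≅ (~unitʳ P)          = ⨾-unitʳ P

    ~s⇒≅s : ∀ {Ms Ns Ms' Ns' : Tms Γ G} {Ps : Reds Γ G Ms Ns} {Qs : Reds Γ G Ms' Ns'} →
            Ps ~s Qs → Ps ≅s Qs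
    ~s⇒≅s []       = []
    ~s⇒≅s (e ∷ es) = ~⇒≅ e ∷ ~s⇒≅s es

  ~s-refl : ∀ {Ms Ns : Tms Γ G} (Ps : Reds Γ G Ms Ns) → Ps ~s Ps
  ~s-refl []       = []
  ~s-refl (P ∷ Ps) = ~refl ∷ ~s-refl Ps

  ~s-trans : ∀ {Ms Ns Ms' Ns' Ms'' Ns'' : Tms Γ G} {Ps : Reds Γ G Ms Ns} {Qs : Reds Γ G Ms' Ns'}
             {Us : Reds Γ G Ms'' Ns''} → Ps ~s Qs → Qs ~s Us → Ps ~s Us
  ~s-trans []       []         = []
  ~s-trans (e ∷ es) (e' ∷ es') = ~trans e e' ∷ ~s-trans es es'

  ≡⇒~ : ∀ {M N : Tm Γ A} {P Q : Red Γ A M N} → P ≡ Q → P ~ Q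
  ≡⇒~ refl = ~refl

  ≡⇒~s : ∀ {Ms Ns : Tms Γ G} {Ps Qs : Reds Γ G Ms Ns} → Ps ≡ Qs → Ps ~s Qs
  ≡⇒~s refl = ~s-refl _

  reflR-cong : {M M' : Tm Γ A} → M ≈ M' → reflR M ~ reflR M'
  reflR-cong {M = M} {M'} e =
    ~trans (~sym (~conv e e (reflR M)))
    (~trans (~sym (~unitʳ (conv e e (reflR M))))
    (~trans (~⨾ (~conv e e (reflR M)) (~sym (~conv (≈sym e) (≈sym e) (reflR M'))))
    (~trans (~unitˡ (conv (≈sym e) (≈sym e) (reflR M')))
    (~conv (≈sym e) (≈sym e) (reflR M')))))

  mutual
    reflR-subʳ : (M : Tm G A) (σ : Tms Γ G) → reflR M [ σ ]ʳ ≡ reflR (sub M σ)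
    reflR-subʳ (var x)    σ = refl
    reflR-subʳ unit       σ = refl
    reflR-subʳ (pair M N) σ = cong₂ rpair (reflR-subʳ M σ) (reflR-subʳ N σ)
    reflR-subʳ (fst M)    σ = cong rfst (reflR-subʳ M σ)
    reflR-subʳ (snd M)    σ = cong rsnd (reflR-subʳ M σ)
    reflR-subʳ (lam M)    σ = cong rlam (reflR-subʳ M (lift σ))
    reflR-subʳ (app M N)  σ = cong₂ rapp (reflR-subʳ M σ) (reflR-subʳ N σ)
    reflR-subʳ (op c Ms)  σ = cong (rop c) (reflRs-subʳ Ms σ)

    reflRs-subʳ : (Ms : Tms G Δ) (σ : Tms Γ G) → reflRs Ms [ σ ]ʳs ≡ reflRs (subs Ms σ)
    reflRs-subʳ []       σ = refl
    reflRs-subʳ (M ∷ Ms) σ = cong₂ _∷_ (reflR-subʳ M σ) (reflRs-subʳ Ms σ)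

  mutual
    ~-subʳ : ∀ {M N M' N' : Tm G A} {P : Red G A M N} {Q : Red G A M' N'} → P ~ Q →
             (τ : Tms Γ G) → P [ τ ]ʳ ~ Q [ τ ]ʳ
    ~-subʳ ~refl               τ = ~refl
    ~-subʳ (~sym e)            τ = ~sym (~-subʳ e τ)
    ~-subʳ (~trans e e')       τ = ~trans (~-subʳ e τ) (~-subʳ e' τ)
    ~-subʳ (~conv p q P)       τ = ~conv _ _ _
    ~-subʳ (~rule r es)        τ = ~trans (~conv _ _ _) (~trans (~rule r (~s-subʳ es τ)) (~sym (~conv _ _ _)))
    ~-subʳ (~rule-tr p q r Ps) τ = ~trans (~conv _ _ _) (~trans (~rule-tr p q r _) (~sym (~conv _ _ _)))
    ~-subʳ (~⨾ e e')           τ = ~⨾ (~-subʳ e τ) (~-subʳ e' τ)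
    ~-subʳ (~rop c es)         τ = ~rop c (~s-subʳ es τ)
    ~-subʳ (~rlam e)           τ = ~rlam (~-subʳ e (lift τ))
    ~-subʳ (~rapp e e')        τ = ~rapp (~-subʳ e τ) (~-subʳ e' τ)
    ~-subʳ (~rpair e e')       τ = ~rpair (~-subʳ e τ) (~-subʳ e' τ)
    ~-subʳ (~rfst e)           τ = ~rfst (~-subʳ e τ)
    ~-subʳ (~rsnd e)           τ = ~rsnd (~-subʳ e τ)
    ~-subʳ (~unitˡ {M = M} P)  τ =
      subst (λ U → (U ⨾ P [ τ ]ʳ) ~ P [ τ ]ʳ) (sym (reflR-subʳ M τ)) (~unitˡ (P [ τ ]ʳ))
    ~-subʳ (~unitʳ {N = N} P)  τ =
      subst (λ U → (P [ τ ]ʳ ⨾ U) ~ P [ τ ]ʳ) (sym (reflR-subʳ N τ)) (~unitʳ (P [ τ ]ʳ))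

    ~s-subʳ : ∀ {Ms Ns Ms' Ns' : Tms G Δ} {Ps : Reds G Δ Ms Ns} {Qs : Reds G Δ Ms' Ns'} → Ps ~s Qs →
              (τ : Tms Γ G) → Ps [ τ ]ʳs ~s Qs [ τ ]ʳs
    ~s-subʳ []       τ = []
    ~s-subʳ (e ∷ es) τ = ~-subʳ e τ ∷ ~s-subʳ es τ

  renR-cong : (ρ : Ren G Γ) {M N M' N' : Tm G A} {P : Red G A M N} {Q : Red G A M' N'} →
              P ~ Q → renR ρ P ~ renR ρ Q
  renR-cong ρ e = ~trans (~conv _ _ _) (~trans (~-subʳ e _) (~sym (~conv _ _ _)))

  renRs-cong : (ρ : Ren G Γ) {Ms Ns Ms' Ns' : Tms G Δ} {Ps : Reds G Δ Ms Ns} {Qs : Reds G Δ Ms' Ns'} →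
               Ps ~s Qs → renRs ρ Ps ~s renRs ρ Qs
  renRs-cong ρ []       = []
  renRs-cong ρ (e ∷ es) = renR-cong ρ e ∷ renRs-cong ρ es

  lookupR-cong : ∀ {Ss Ts Ss' Ts' : Tms Γ G} {Qs : Reds Γ G Ss Ts} {Qs' : Reds Γ G Ss' Ts'} →
                 Qs ~s Qs' → (x : G ∋ A) → lookupR Qs x ~ lookupR Qs' x
  lookupR-cong (e ∷ es) here      = e
  lookupR-cong (e ∷ es) (there x) = lookupR-cong es x

  mutual
    whisker-cong : (M : Tm G A) {Ss Ts Ss' Ts' : Tms Γ G} {Qs : Reds Γ G Ss Ts} {Qs' : Reds Γ G Ss' Ts'} →
                   Qs ~s Qs' → M ⟨ Qs ⟩ˡ ~ M ⟨ Qs' ⟩ˡ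
    whisker-cong (var x)    e = lookupR-cong e x
    whisker-cong unit       e = ~refl
    whisker-cong (pair M N) e = ~rpair (whisker-cong M e) (whisker-cong N e)
    whisker-cong (fst M)    e = ~rfst (whisker-cong M e)
    whisker-cong (snd M)    e = ~rsnd (whisker-cong M e)
    whisker-cong (lam M)    e = ~rlam (whisker-cong M (~refl ∷ renRs-cong there e))
    whisker-cong (app M N)  e = ~rapp (whisker-cong M e) (whisker-cong N e)
    whisker-cong (op c Ms)  e = ~rop c (whiskers-cong Ms e)

    whiskers-cong : (Ms : Tms G Δ) {Ss Ts Ss' Ts' : Tms Γ G} {Qs : Reds Γ G Ss Ts} {Qs' : Reds Γ G Ss' Ts'} →
                    Qs ~s Qs' → Ms ⟨ Qs ⟩ˡs ~s Ms ⟨ Qs' ⟩ˡs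
    whiskers-cong []       e = []
    whiskers-cong (M ∷ Ms) e = whisker-cong M e ∷ whiskers-cong Ms e

  mutual
    subʳ-cong : ∀ {M N : Tm G A} (P : Red G A M N) {σ σ' : Tms Γ G} → σ ≈s σ' → P [ σ ]ʳ ~ P [ σ' ]ʳ
    subʳ-cong (rule r Ps)  e = ~trans (~conv _ _ _) (~trans (~rule r (subsʳ-cong Ps e)) (~sym (~conv _ _ _)))
    subʳ-cong (P ⨾ Q)      e = ~⨾ (subʳ-cong P e) (subʳ-cong Q e)
    subʳ-cong (conv p q P) e = ~trans (~conv _ _ _) (~trans (subʳ-cong P e) (~sym (~conv _ _ _)))
    subʳ-cong (rvar x)     e = reflR-cong (lookup-cong e x)
    subʳ-cong runit        e = ~refl
    subʳ-cong (rop c Ps)   e = ~rop c (subsʳ-cong Ps e)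
    subʳ-cong (rlam P)     e = ~rlam (subʳ-cong P (lift-cong e))
    subʳ-cong (rapp P Q)   e = ~rapp (subʳ-cong P e) (subʳ-cong Q e)
    subʳ-cong (rpair P Q)  e = ~rpair (subʳ-cong P e) (subʳ-cong Q e)
    subʳ-cong (rfst P)     e = ~rfst (subʳ-cong P e)
    subʳ-cong (rsnd P)     e = ~rsnd (subʳ-cong P e)

    subsʳ-cong : ∀ {Ms Ns : Tms G Δ} (Ps : Reds G Δ Ms Ns) {σ σ' : Tms Γ G} → σ ≈s σ' →
                 Ps [ σ ]ʳs ~s Ps [ σ' ]ʳs
    subsʳ-cong []       e = []
    subsʳ-cong (P ∷ Ps) e = subʳ-cong P e ∷ subsʳ-cong Ps e

  mutual
    subʳ-subʳ : ∀ {M N : Tm G A} (P : Red G A M N) (σ : Tms Δ G) (τ : Tms Γ Δ) →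
                (P [ σ ]ʳ) [ τ ]ʳ ~ P [ subs σ τ ]ʳ
    subʳ-subʳ (rule r Ps) σ τ =
      ~trans (~conv _ _ _) (~trans (~conv _ _ _) (~trans (~rule r (subsʳ-subʳ Ps σ τ)) (~sym (~conv _ _ _))))
    subʳ-subʳ (P ⨾ Q)      σ τ = ~⨾ (subʳ-subʳ P σ τ) (subʳ-subʳ Q σ τ)
    subʳ-subʳ (conv p q P) σ τ = ~trans (~conv _ _ _) (~trans (subʳ-subʳ P σ τ) (~sym (~conv _ _ _)))
    subʳ-subʳ (rvar x)     σ τ =
      ~trans (≡⇒~ (reflR-subʳ (lookup σ x) τ)) (reflR-cong (≡⇒≈ (sym (lookup-subs σ τ x))))
    subʳ-subʳ runit        σ τ = ~refl
    subʳ-subʳ (rop c Ps)   σ τ = ~rop c (subsʳ-subʳ Ps σ τ)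
    subʳ-subʳ (rlam P)     σ τ =
      ~rlam (~trans (subʳ-subʳ P (lift σ) (lift τ)) (subʳ-cong P (lift-subs σ τ)))
    subʳ-subʳ (rapp P Q)   σ τ = ~rapp (subʳ-subʳ P σ τ) (subʳ-subʳ Q σ τ)
    subʳ-subʳ (rpair P Q)  σ τ = ~rpair (subʳ-subʳ P σ τ) (subʳ-subʳ Q σ τ)
    subʳ-subʳ (rfst P)     σ τ = ~rfst (subʳ-subʳ P σ τ)
    subʳ-subʳ (rsnd P)     σ τ = ~rsnd (subʳ-subʳ P σ τ)

    subsʳ-subʳ : ∀ {Ms Ns : Tms G Θ} (Ps : Reds G Θ Ms Ns) (σ : Tms Δ G) (τ : Tms Γ Δ) →
                 (Ps [ σ ]ʳs) [ τ ]ʳs ~s Ps [ subs σ τ ]ʳs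
    subsʳ-subʳ []       σ τ = []
    subsʳ-subʳ (P ∷ Ps) σ τ = subʳ-subʳ P σ τ ∷ subsʳ-subʳ Ps σ τ

  mutual
    subʳ-id : ∀ {M N : Tm Γ A} (P : Red Γ A M N) → P [ idTms Γ ]ʳ ~ P
    subʳ-id (rule r Ps)  = ~trans (~conv _ _ _) (~rule r (subsʳ-id Ps))
    subʳ-id (P ⨾ Q)      = ~⨾ (subʳ-id P) (subʳ-id Q)
    subʳ-id (conv p q P) = ~trans (~conv _ _ _) (~trans (subʳ-id P) (~sym (~conv _ _ _)))
    subʳ-id (rvar x)     = reflR-cong (sub-id (var x))
    subʳ-id runit        = ~refl
    subʳ-id (rop c Ps)   = ~rop c (subsʳ-id Ps)
    subʳ-id (rlam P)     = ~rlam (subʳ-id P)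
    subʳ-id (rapp P Q)   = ~rapp (subʳ-id P) (subʳ-id Q)
    subʳ-id (rpair P Q)  = ~rpair (subʳ-id P) (subʳ-id Q)
    subʳ-id (rfst P)     = ~rfst (subʳ-id P)
    subʳ-id (rsnd P)     = ~rsnd (subʳ-id P)

    subsʳ-id : ∀ {Ms Ns : Tms Γ G} (Ps : Reds Γ G Ms Ns) → Ps [ idTms Γ ]ʳs ~s Ps
    subsʳ-id []       = []
    subsʳ-id (P ∷ Ps) = subʳ-id P ∷ subsʳ-id Ps

  renR-lift : ∀ {M N : Tm Δ B} (Q : Red Δ B M N) (τ : Tms Γ Δ) →
              renR (there {B = A}) Q [ lift τ ]ʳ ~ renR there (Q [ τ ]ʳ)
  renR-lift Q τ =
    ~trans (~conv _ _ _) (~trans (subʳ-subʳ Q (varsOf there) (lift τ))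
    (~trans (subʳ-cong Q (weaken-lift τ)) (~trans (~sym (subʳ-subʳ Q τ (varsOf there))) (~sym (~conv _ _ _)))))

  renRs-lift : ∀ {Ss Ts : Tms Δ G} (Qs : Reds Δ G Ss Ts) (τ : Tms Γ Δ) →
               renRs (there {B = A}) Qs [ lift τ ]ʳs ~s renRs there (Qs [ τ ]ʳs)
  renRs-lift []       τ = []
  renRs-lift (Q ∷ Qs) τ = renR-lift Q τ ∷ renRs-lift Qs τ

  lookupR-subʳ : ∀ {Ss Ts : Tms Δ G} (Qs : Reds Δ G Ss Ts) (τ : Tms Γ Δ) (x : G ∋ A) →
                 lookupR Qs x [ τ ]ʳ ~ lookupR (Qs [ τ ]ʳs) x
  lookupR-subʳ (Q ∷ Qs) τ here      = ~refl
  lookupR-subʳ (Q ∷ Qs) τ (there x) = lookupR-subʳ Qs τ x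

  mutual
    whisker-subʳ : (M : Tm G A) {Ss Ts : Tms Δ G} (Qs : Reds Δ G Ss Ts) (τ : Tms Γ Δ) →
                   (M ⟨ Qs ⟩ˡ) [ τ ]ʳ ~ M ⟨ Qs [ τ ]ʳs ⟩ˡ
    whisker-subʳ (var x)    Qs τ = lookupR-subʳ Qs τ x
    whisker-subʳ unit       Qs τ = ~refl
    whisker-subʳ (pair M N) Qs τ = ~rpair (whisker-subʳ M Qs τ) (whisker-subʳ N Qs τ)
    whisker-subʳ (fst M)    Qs τ = ~rfst (whisker-subʳ M Qs τ)
    whisker-subʳ (snd M)    Qs τ = ~rsnd (whisker-subʳ M Qs τ)
    whisker-subʳ (lam M)    Qs τ =
      ~rlam (~trans (whisker-subʳ M (liftR Qs) (lift τ)) (whisker-cong M (~refl ∷ renRs-lift Qs τ)))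
    whisker-subʳ (app M N)  Qs τ = ~rapp (whisker-subʳ M Qs τ) (whisker-subʳ N Qs τ)
    whisker-subʳ (op c Ms)  Qs τ = ~rop c (whiskers-subʳ Ms Qs τ)

    whiskers-subʳ : (Ms : Tms G Θ) {Ss Ts : Tms Δ G} (Qs : Reds Δ G Ss Ts) (τ : Tms Γ Δ) →
                    (Ms ⟨ Qs ⟩ˡs) [ τ ]ʳs ~s Ms ⟨ Qs [ τ ]ʳs ⟩ˡs
    whiskers-subʳ []       Qs τ = []
    whiskers-subʳ (M ∷ Ms) Qs τ = whisker-subʳ M Qs τ ∷ whiskers-subʳ Ms Qs τ

  restrict : (ρ : Ren G Δ) {Ss Ts : Tms Γ Δ} → Reds Γ Δ Ss Ts →
             Reds Γ G (subs (varsOf ρ) Ss) (subs (varsOf ρ) Ts)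
  restrict {G = []}    ρ Qs = []
  restrict {G = A ∷ G} ρ Qs = lookupR Qs (ρ here) ∷ restrict (λ x → ρ (there x)) Qs

  restrict-there : (ρ : Ren G Δ) {S T : Tm Γ A} {Ss Ts : Tms Γ Δ} (Q : Red Γ A S T) (Qs : Reds Γ Δ Ss Ts) →
                   restrict (λ x → there (ρ x)) (Q ∷ Qs) ~s restrict ρ Qs
  restrict-there {G = []}    ρ Q Qs = []
  restrict-there {G = A ∷ G} ρ Q Qs = ~refl ∷ restrict-there (λ x → ρ (there x)) Q Qs

  restrict-id : {Ss Ts : Tms Γ Δ} (Qs : Reds Γ Δ Ss Ts) → restrict (λ x → x) Qs ~s Qs
  restrict-id []       = []
  restrict-id (Q ∷ Qs) = ~refl ∷ ~s-trans (restrict-there (λ x → x) Q Qs) (restrict-id Qs)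

  lookupR-renRs : (ρ : Ren Γ Θ) {Ss Ts : Tms Γ Δ} (Qs : Reds Γ Δ Ss Ts) (x : Δ ∋ A) →
                  lookupR (renRs ρ Qs) x ~ renR ρ (lookupR Qs x)
  lookupR-renRs ρ (Q ∷ Qs) here      = ~refl
  lookupR-renRs ρ (Q ∷ Qs) (there x) = lookupR-renRs ρ Qs x

  restrict-renRs : (ρ : Ren G Δ) (ρ' : Ren Γ Θ) {Ss Ts : Tms Γ Δ} (Qs : Reds Γ Δ Ss Ts) →
                   restrict ρ (renRs ρ' Qs) ~s renRs ρ' (restrict ρ Qs)
  restrict-renRs {G = []}    ρ ρ' Qs = []
  restrict-renRs {G = A ∷ G} ρ ρ' Qs =
    lookupR-renRs ρ' Qs (ρ here) ∷ restrict-renRs (λ x → ρ (there x)) ρ' Qs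

  lookupR-restrict : (ρ : Ren G Δ) {Ss Ts : Tms Γ Δ} (Qs : Reds Γ Δ Ss Ts) (x : G ∋ A) →
                     lookupR Qs (ρ x) ~ lookupR (restrict ρ Qs) x
  lookupR-restrict ρ Qs here      = ~refl
  lookupR-restrict ρ Qs (there x) = lookupR-restrict (λ y → ρ (there y)) Qs x

  mutual
    ren-whisker : (ρ : Ren G Δ) (M : Tm G A) {Ss Ts : Tms Γ Δ} (Qs : Reds Γ Δ Ss Ts) →
                  ren ρ M ⟨ Qs ⟩ˡ ~ M ⟨ restrict ρ Qs ⟩ˡ
    ren-whisker ρ (var x)    Qs = lookupR-restrict ρ Qs x
    ren-whisker ρ unit       Qs = ~refl
    ren-whisker ρ (pair M N) Qs = ~rpair (ren-whisker ρ M Qs) (ren-whisker ρ N Qs)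
    ren-whisker ρ (fst M)    Qs = ~rfst (ren-whisker ρ M Qs)
    ren-whisker ρ (snd M)    Qs = ~rsnd (ren-whisker ρ M Qs)
    ren-whisker ρ (lam M)    Qs =
      ~rlam (~trans (ren-whisker (liftRen ρ) M (liftR Qs))
        (whisker-cong M (~refl ∷ ~s-trans (restrict-there ρ (rvar here) (renRs there Qs))
                                          (restrict-renRs ρ there Qs))))
    ren-whisker ρ (app M N)  Qs = ~rapp (ren-whisker ρ M Qs) (ren-whisker ρ N Qs)
    ren-whisker ρ (op c Ms)  Qs = ~rop c (ren-whiskers ρ Ms Qs)

    ren-whiskers : (ρ : Ren G Δ) (Ms : Tms G Θ) {Ss Ts : Tms Γ Δ} (Qs : Reds Γ Δ Ss Ts) →
                   rens ρ Ms ⟨ Qs ⟩ˡs ~s Ms ⟨ restrict ρ Qs ⟩ˡs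
    ren-whiskers ρ []       Qs = []
    ren-whiskers ρ (M ∷ Ms) Qs = ren-whisker ρ M Qs ∷ ren-whiskers ρ Ms Qs

  renRs-weaken : {Ss Ts : Tms Γ Δ} (Qs : Reds Γ Δ Ss Ts) → renRs (there {B = A}) Qs ~s Qs [ varsOf there ]ʳs
  renRs-weaken []       = []
  renRs-weaken (Q ∷ Qs) = ~conv _ _ _ ∷ renRs-weaken Qs

  weaken-whisker : (N : Tm G B) {Ss Ts : Tms Γ G} (Qs : Reds Γ G Ss Ts) →
                   ren (there {B = A}) N ⟨ liftR Qs ⟩ˡ ~ renR there (N ⟨ Qs ⟩ˡ)
  weaken-whisker N Qs =
    ~trans (ren-whisker there N (liftR Qs))
    (~trans (whisker-cong N (~s-trans (restrict-there (λ x → x) (rvar here) (renRs there Qs))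
                            (~s-trans (restrict-id (renRs there Qs)) (renRs-weaken Qs))))
    (~trans (~sym (whisker-subʳ N Qs (varsOf there))) (~sym (~conv _ _ _))))

  weaken-whiskers : (σ : Tms G Δ) {Ss Ts : Tms Γ G} (Qs : Reds Γ G Ss Ts) →
                    rens (there {B = A}) σ ⟨ liftR Qs ⟩ˡs ~s renRs there (σ ⟨ Qs ⟩ˡs)
  weaken-whiskers []      Qs = []
  weaken-whiskers (N ∷ σ) Qs = weaken-whisker N Qs ∷ weaken-whiskers σ Qs

  lookup-whisker : (σ : Tms G Δ) {Ss Ts : Tms Γ G} (Qs : Reds Γ G Ss Ts) (x : Δ ∋ A) →
                   lookup σ x ⟨ Qs ⟩ˡ ~ lookupR (σ ⟨ Qs ⟩ˡs) x
  lookup-whisker (N ∷ σ) Qs here      = ~refl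
  lookup-whisker (N ∷ σ) Qs (there x) = lookup-whisker σ Qs x

  mutual
    sub-whisker : (M : Tm Δ A) (σ : Tms G Δ) {Ss Ts : Tms Γ G} (Qs : Reds Γ G Ss Ts) →
                  sub M σ ⟨ Qs ⟩ˡ ~ M ⟨ σ ⟨ Qs ⟩ˡs ⟩ˡ
    sub-whisker (var x)    σ Qs = lookup-whisker σ Qs x
    sub-whisker unit       σ Qs = ~refl
    sub-whisker (pair M N) σ Qs = ~rpair (sub-whisker M σ Qs) (sub-whisker N σ Qs)
    sub-whisker (fst M)    σ Qs = ~rfst (sub-whisker M σ Qs)
    sub-whisker (snd M)    σ Qs = ~rsnd (sub-whisker M σ Qs)
    sub-whisker (lam M)    σ Qs =
      ~rlam (~trans (sub-whisker M (lift σ) (liftR Qs)) (whisker-cong M (~refl ∷ weaken-whiskers σ Qs)))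
    sub-whisker (app M N)  σ Qs = ~rapp (sub-whisker M σ Qs) (sub-whisker N σ Qs)
    sub-whisker (op c Ms)  σ Qs = ~rop c (sub-whiskers Ms σ Qs)

    sub-whiskers : (Ms : Tms Δ Θ) (σ : Tms G Δ) {Ss Ts : Tms Γ G} (Qs : Reds Γ G Ss Ts) →
                   subs Ms σ ⟨ Qs ⟩ˡs ~s Ms ⟨ σ ⟨ Qs ⟩ˡs ⟩ˡs
    sub-whiskers []       σ Qs = []
    sub-whiskers (M ∷ Ms) σ Qs = sub-whisker M σ Qs ∷ sub-whiskers Ms σ Qs

  renR-reflR : (N : Tm Γ B) → renR (there {B = A}) (reflR N) ~ reflR (ren there N)
  renR-reflR N =
    ~trans (~conv _ _ _) (~trans (≡⇒~ (reflR-subʳ N (varsOf there))) (reflR-cong (≈sym (ren-sub there N))))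

  renRs-reflRs : (σ : Tms Γ G) → renRs (there {B = A}) (reflRs σ) ~s reflRs (rens there σ)
  renRs-reflRs []      = []
  renRs-reflRs (N ∷ σ) = renR-reflR N ∷ renRs-reflRs σ

  lookupR-reflRs : (σ : Tms Γ G) (x : G ∋ A) → lookupR (reflRs σ) x ~ reflR (lookup σ x)
  lookupR-reflRs (N ∷ σ) here      = ~refl
  lookupR-reflRs (N ∷ σ) (there x) = lookupR-reflRs σ x

  mutual
    whisker-reflRs : (M : Tm G A) (σ : Tms Γ G) → M ⟨ reflRs σ ⟩ˡ ~ reflR (sub M σ)
    whisker-reflRs (var x)    σ = lookupR-reflRs σ x
    whisker-reflRs unit       σ = ~refl
    whisker-reflRs (pair M N) σ = ~rpair (whisker-reflRs M σ) (whisker-reflRs N σ)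
    whisker-reflRs (fst M)    σ = ~rfst (whisker-reflRs M σ)
    whisker-reflRs (snd M)    σ = ~rsnd (whisker-reflRs M σ)
    whisker-reflRs (lam M)    σ =
      ~rlam (~trans (whisker-cong M (~refl ∷ renRs-reflRs σ)) (whisker-reflRs M (lift σ)))
    whisker-reflRs (app M N)  σ = ~rapp (whisker-reflRs M σ) (whisker-reflRs N σ)
    whisker-reflRs (op c Ms)  σ = ~rop c (whiskers-reflRs Ms σ)

    whiskers-reflRs : (Ms : Tms G Δ) (σ : Tms Γ G) → Ms ⟨ reflRs σ ⟩ˡs ~s reflRs (subs Ms σ)
    whiskers-reflRs []       σ = []
    whiskers-reflRs (M ∷ Ms) σ = whisker-reflRs M σ ∷ whiskers-reflRs Ms σ

  subst-identity : ∀ {M N : Tm G A} (P : Red G A M N) {σ : Tms Γ G} {Qs : Reds Γ G σ σ} →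
                   Qs ~s reflRs σ → (P ⟦ Qs ⟧) ~ P [ σ ]ʳ
  subst-identity {N = N} P {σ} e =
    ~trans (~⨾ ~refl (~trans (whisker-cong N e) (whisker-reflRs N σ))) (~unitʳ _)

  reflR-subst-identity : (M : Tm G A) {σ : Tms Γ G} {Qs : Reds Γ G σ σ} → Qs ~s reflRs σ →
                         (reflR M ⟦ Qs ⟧) ~ reflR (sub M σ)
  reflR-subst-identity M {σ} e = ~trans (subst-identity (reflR M) e) (≡⇒~ (reflR-subʳ M σ))

  ηR-instance : ∀ {g g' : Tm (B ∷ []) A} (r : R (B ∷ []) A g g') (t : Tm Γ B) →
                ηR r [ t ∷ [] ]ʳ ~ rule r (reflR t ∷ [])
  ηR-instance r t = ~trans (~conv _ _ _) (~conv _ _ _)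

  ηR-tr : ∀ {M M' N N' : Tm G A} (p : M ≈ M') (q : N ≈ N') (r : R G A M N) → ηR r ~ ηR (tr p q r)
  ηR-tr p q r = ~trans (~conv _ _ _) (~trans (~sym (~rule-tr p q r _)) (~sym (~conv _ _ _)))

module LmapIdentity {S : Set} {Op : Arity S} {R₁ R₂ : RuleFam S Op}
  (f : ∀ {G A M N} → R₁ G A M N → R₂ G A M N) where

  open Syntax Op
  open LMap {R₁ = R₁} {R₂ = R₂} f
  private
    module Red₁ = Reductions R₁
    module Red₂ = Reductions R₂
    variable
      A : Ty S
      Γ G : Ctx S

  mutual
    Lmap-reflR : (M : Tm Γ A) → Lmap (Red₁.reflR M) ≡ Red₂.reflR M
    Lmap-reflR (var x)    = refl
    Lmap-reflR unit       = refl
    Lmap-reflR (pair M N) = cong₂ Red₂.rpair (Lmap-reflR M) (Lmap-reflR N)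
    Lmap-reflR (fst M)    = cong Red₂.rfst (Lmap-reflR M)
    Lmap-reflR (snd M)    = cong Red₂.rsnd (Lmap-reflR M)
    Lmap-reflR (lam M)    = cong Red₂.rlam (Lmap-reflR M)
    Lmap-reflR (app M N)  = cong₂ Red₂.rapp (Lmap-reflR M) (Lmap-reflR N)
    Lmap-reflR (op c Ms)  = cong (Red₂.rop c) (Lmaps-reflRs Ms)

    Lmaps-reflRs : (Ms : Tms Γ G) → Lmaps (Red₁.reflRs Ms) ≡ Red₂.reflRs Ms
    Lmaps-reflRs []       = refl
    Lmaps-reflRs (M ∷ Ms) = cong₂ Red₂._∷_ (Lmap-reflR M) (Lmaps-reflRs Ms)

module MultiplicationLemmas {S : Set} {Op : Arity S} (R : RuleFam S Op)
  (tr : ∀ {G A} {M M' N N' : Syntax.Tm Op G A} →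
        Syntax._≈_ Op M M' → Syntax._≈_ Op N N' → R G A M N → R G A M' N') where

  open Syntax Op
  open Reductions R
  open StructuralEquivalence R tr
  open Mult R
  private
    module R₂ = Reductions Red
    variable
      A : Ty S
      Γ G : Ctx S

  mutual
    μ-reflR : (M : Tm Γ A) → μ (R₂.reflR M) ≡ reflR M
    μ-reflR (var x)    = refl
    μ-reflR unit       = refl
    μ-reflR (pair M N) = cong₂ rpair (μ-reflR M) (μ-reflR N)
    μ-reflR (fst M)    = cong rfst (μ-reflR M)
    μ-reflR (snd M)    = cong rsnd (μ-reflR M)
    μ-reflR (lam M)    = cong rlam (μ-reflR M)
    μ-reflR (app M N)  = cong₂ rapp (μ-reflR M) (μ-reflR N)
    μ-reflR (op c Ms)  = cong (rop c) (μs-reflRs Ms)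

    μs-reflRs : (Ms : Tms Γ G) → μs (R₂.reflRs Ms) ≡ reflRs Ms
    μs-reflRs []       = refl
    μs-reflRs (M ∷ Ms) = cong₂ _∷_ (μ-reflR M) (μs-reflRs Ms)

  μ-ηR : ∀ {M N : Tm G A} (P : Red G A M N) → μ (R₂.ηR P) ~ P
  μ-ηR {G = G} P =
    ~trans (~conv _ _ _) (~trans (subst-identity P (≡⇒~s (μs-reflRs (idTms G)))) (subʳ-id P))

module AlgebraLemmas (X : Sig₂)
  (h : ∀ {G A M N} → Reductions.Red (Sig₂.Rule X) G A M N → Sig₂.Rule X G A M N)
  (alg : IsAlgebra X h) where

  open Sig₂ X
  open Syntax Op
  open Reductions Rule
  open Permutation Rule tr
  open StructuralEquivalence Rule tr public
  open MultiplicationLemmas Rule tr public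
  open LmapIdentity {R₁ = Red} {R₂ = Rule} h public
  open IsAlgebra alg
  open LMap {R₁ = Red} {R₂ = Rule} h
  open Mult Rule
  module R₂ = Reductions Red

  private variable
    A B C : Ty Sort
    Γ G : Ctx Sort

  Lmap-ηR : ∀ {M N : Tm G A} (P : Red G A M N) → Lmap (R₂.ηR P) ~ ηR (h P)
  Lmap-ηR {G = G} P =
    ~trans (~conv _ _ _) (~trans (~rule (h P) (≡⇒~s (Lmaps-reflRs (idTms G)))) (~sym (~conv _ _ _)))

  Lmap-ηR-ηR : ∀ {M N : Tm G A} (r : Rule G A M N) → Lmap (R₂.ηR (ηR r)) ~ ηR r
  Lmap-ηR-ηR r = ~trans (Lmap-ηR (ηR r)) (≡⇒~ (cong ηR (h-unit r)))

  h-≅ : ∀ {M N : Tm Γ A} {P Q : Red Γ A M N} → P ≅ Q → h P ≡ h Q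
  h-≅ {P = P} e = trans (sym (tr-id ≈refl ≈refl (h P))) (h-resp e ≈refl ≈refl)

  h-~ : ∀ {M N : Tm Γ A} {P Q : Red Γ A M N} → P ~ Q → h P ≡ h Q
  h-~ e = h-≅ (~⇒≅ e)

  h-coherence-tr : ∀ {M N M' N' : Tm Γ A} (Φ : R₂.Red Γ A M N) {P : Red Γ A M N} {Q : Red Γ A M' N'} →
                   Lmap Φ ≅ P → μ Φ ≅ Q → (p : M ≈ M') (q : N ≈ N') → tr p q (h P) ≡ h Q
  h-coherence-tr Φ e₁ e₂ p q = trans (cong (tr p q) (trans (sym (h-≅ e₁)) (h-mult Φ))) (h-resp e₂ p q)

  h-coherence : ∀ {M N : Tm Γ A} (Φ : R₂.Red Γ A M N) {P Q : Red Γ A M N} →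
                Lmap Φ ≅ P → μ Φ ≅ Q → h P ≡ h Q
  h-coherence Φ e₁ e₂ = trans (sym (tr-id ≈refl ≈refl _)) (h-coherence-tr Φ e₁ e₂ ≈refl ≈refl)

  h-rule-ηR : ∀ {g g' : Tm (B ∷ []) C} {f f' : Tm Γ B} (r : Rule (B ∷ []) C g g') (P : Red Γ B f f') →
              h (rule r (ηR (h P) ∷ [])) ≡ h (rule r (P ∷ []))
  h-rule-ηR {f = f} r P = h-coherence (R₂.rule (ηR r) (R₂.ηR P R₂.∷ R₂.[]))
    (~⇒≅ (~trans (~rule (h (ηR r)) (Lmap-ηR P ∷ [])) (≡⇒~ (cong (λ z → rule z (ηR (h P) ∷ [])) (h-unit r)))))
    (≅trans (⨾-cong (~⇒≅ (ηR-instance r f)) ≅refl)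
    (≅trans (≅sym (rule-⨾ʳ r (reflR f ∷ []) (μ (R₂.ηR P) ∷ [])))
      (rule-cong r (~⇒≅ (~trans (~unitˡ _) (μ-ηR P)) ∷ []))))

  h-⨾ : ∀ {M₁ M₂ M₃ : Tm Γ A} (P : Red Γ A M₁ M₂) (Q : Red Γ A M₂ M₃) → h (ηR (h P) ⨾ ηR (h Q)) ≡ h (P ⨾ Q)
  h-⨾ P Q = h-coherence (R₂.ηR P R₂.⨾ R₂.ηR Q)
    (~⇒≅ (~⨾ (Lmap-ηR P) (Lmap-ηR Q))) (~⇒≅ (~⨾ (μ-ηR P) (μ-ηR Q)))

  h-⨾ˡ : ∀ {M₁ M₂ M₃ : Tm Γ A} (P : Red Γ A M₁ M₂) (γ : Rule Γ A M₂ M₃) →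
         h (ηR (h P) ⨾ ηR γ) ≡ h (P ⨾ ηR γ)
  h-⨾ˡ P γ = h-coherence (R₂.ηR P R₂.⨾ R₂.ηR (ηR γ))
    (~⇒≅ (~⨾ (Lmap-ηR P) (Lmap-ηR-ηR γ))) (~⇒≅ (~⨾ (μ-ηR P) (μ-ηR (ηR γ))))

  h-⨾ʳ : ∀ {M₁ M₂ M₃ : Tm Γ A} (γ : Rule Γ A M₁ M₂) (Q : Red Γ A M₂ M₃) →
         h (ηR γ ⨾ ηR (h Q)) ≡ h (ηR γ ⨾ Q)
  h-⨾ʳ γ Q = h-coherence (R₂.ηR (ηR γ) R₂.⨾ R₂.ηR Q)
    (~⇒≅ (~⨾ (Lmap-ηR-ηR γ) (Lmap-ηR Q))) (~⇒≅ (~⨾ (μ-ηR (ηR γ)) (μ-ηR Q)))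

  h-whisker : ∀ {f f' : Tm Γ B} (M : Tm (B ∷ []) C) (P : Red Γ B f f') {r : Rule Γ B f f'} → h P ≡ r →
              h (rule (h (reflR M)) (ηR r ∷ [])) ≡ h (M ⟨ P ∷ [] ⟩ˡ)
  h-whisker {f = f} M P e = h-coherence (R₂.rule (reflR M) (R₂.ηR P R₂.∷ R₂.[]))
    (~⇒≅ (~rule _ (~trans (Lmap-ηR P) (≡⇒~ (cong ηR e)) ∷ [])))
    (~⇒≅ (~trans (~⨾ (≡⇒~ (reflR-subʳ M (f ∷ []))) (whisker-cong M (μ-ηR P ∷ []))) (~unitˡ _)))

module TwoCategory (X : Sig₂)
  (h : ∀ {G A M N} → Reductions.Red (Sig₂.Rule X) G A M N → Sig₂.Rule X G A M N)
  (alg : IsAlgebra X h) where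

  open Sig₂ X
  open Syntax Op
  open Reductions Rule
  open Permutation Rule tr
  open SubstitutionLemmas Op
  open AlgebraLemmas X h alg
  open IsAlgebra alg
  open Mult Rule
  open TwoCatData (𝓕 X h) using (Cell; id₁; _∘₁_; id₂; _·_; _*_)

  private variable
    A B C : Ty Sort

  -- the laws of vertical composition are those of ; after removing inner h's
  vertical-assoc : {f g k l : Tm (A ∷ []) B} (α : Cell f g) (β : Cell g k) (γ : Cell k l) →
                   (α · β) · γ ≡ α · (β · γ)
  vertical-assoc α β γ =
    trans (h-⨾ˡ (ηR α ⨾ ηR β) γ) (trans (h-≅ (⨾-assoc _ _ _)) (sym (h-⨾ʳ α (ηR β ⨾ ηR γ))))

  vertical-idˡ : {f g : Tm (A ∷ []) B} (α : Cell f g) → id₂ f · α ≡ α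
  vertical-idˡ {f = f} α = trans (h-⨾ˡ (reflR f) α) (trans (h-~ (~unitˡ (ηR α))) (h-unit α))

  vertical-idʳ : {f g : Tm (A ∷ []) B} (α : Cell f g) → α · id₂ g ≡ α
  vertical-idʳ {g = g} α = trans (h-⨾ʳ α (reflR g)) (trans (h-~ (~unitʳ (ηR α))) (h-unit α))

  -- (β;β')⟨α;α'⟩ and β⟨α⟩;β'⟨α'⟩ are permutation equivalent reductions
  interchange : {f₁ f₂ f₃ : Tm (A ∷ []) B} {g₁ g₂ g₃ : Tm (B ∷ []) C}
                (α : Cell f₁ f₂) (α' : Cell f₂ f₃) (β : Cell g₁ g₂) (β' : Cell g₂ g₃) →
                (α · α') * (β · β') ≡ (α * β) · (α' * β')
  interchange {f₁ = f₁} α α' β β' =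
    trans (h-coherence (R₂.rule (ηR β ⨾ ηR β') (R₂.ηR (ηR α ⨾ ηR α') R₂.∷ R₂.[]))
             (~⇒≅ (~rule _ (Lmap-ηR _ ∷ [])))
             (≅trans (⨾-cong (⨾-cong (~⇒≅ (ηR-instance β f₁)) (~⇒≅ (ηR-instance β' f₁))) ≅refl)
             (≅trans (⨾-assoc _ _ _)
             (≅trans (⨾-cong ≅refl (≅sym (rule-⨾ʳ β' (reflR f₁ ∷ []) (μ (R₂.ηR (ηR α ⨾ ηR α')) ∷ []))))
             (≅trans (⨾-cong ≅refl (rule-cong β' (~⇒≅ (~trans (~unitˡ _) (μ-ηR _)) ∷ [])))
             (≅trans (⨾-cong ≅refl (rule-⨾ˡ β' (ηR α ∷ []) (ηR α' ∷ [])))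
             (≅trans (≅sym (⨾-assoc _ _ _))
             (≅trans (⨾-cong (≅sym (rule-⨾ʳ β (reflR f₁ ∷ []) (ηR α ∷ []))) ≅refl)
             (⨾-cong (rule-cong β (⨾-unitˡ (ηR α) ∷ [])) ≅refl)))))))))
    (sym (h-⨾ (rule β (ηR α ∷ [])) (rule β' (ηR α' ∷ []))))

  horizontal-id₂ : (f : Tm (A ∷ []) B) (g : Tm (B ∷ []) C) → id₂ f * id₂ g ≡ id₂ (g ∘₁ f)
  horizontal-id₂ f g = trans (h-rule-ηR (h (reflR g)) (reflR f))
    (h-coherence (R₂.rule (reflR g) (R₂.reflR f R₂.∷ R₂.[]))
      (~⇒≅ (~rule _ (≡⇒~ (Lmap-reflR f) ∷ [])))
      (~⇒≅ (reflR-subst-identity g (≡⇒~ (μ-reflR f) ∷ []))))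

  -- γ⟨β⟨α⟩⟩ and (γ⟨β⟩)⟨α⟩ are permutation equivalent reductions
  horizontal-assoc : ∀ {D} {f f' : Tm (A ∷ []) B} {g g' : Tm (B ∷ []) C} {k k' : Tm (C ∷ []) D}
                     (u : (k ∘₁ g) ∘₁ f ≈ k ∘₁ (g ∘₁ f)) (u' : (k' ∘₁ g') ∘₁ f' ≈ k' ∘₁ (g' ∘₁ f'))
                     (α : Cell f f') (β : Cell g g') (γ : Cell k k') →
                     tr u u' (α * (β * γ)) ≡ (α * β) * γ
  horizontal-assoc {f = f} {g' = g'} {k' = k'} u u' α β γ =
    trans (h-coherence-tr (R₂.rule (rule γ (ηR β ∷ [])) (R₂.ηR (ηR α) R₂.∷ R₂.[]))
             (~⇒≅ (~rule _ (Lmap-ηR-ηR α ∷ [])))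
             (≅trans (⨾-cong (~⇒≅ (~trans (~conv _ _ _) (~rule γ (ηR-instance β f ∷ []))))
                             (~⇒≅ (sub-whisker k' (g' ∷ []) (μ (R₂.ηR (ηR α)) ∷ []))))
             (≅trans (≅sym (rule-⨾ʳ γ (rule β (reflR f ∷ []) ∷ []) ((g' ⟨ μ (R₂.ηR (ηR α)) ∷ [] ⟩ˡ) ∷ [])))
             (rule-cong γ (≅trans (≅sym (rule-⨾ʳ β (reflR f ∷ []) (μ (R₂.ηR (ηR α)) ∷ [])))
                  (rule-cong β (~⇒≅ (~trans (~unitˡ _) (μ-ηR (ηR α))) ∷ [])) ∷ []))))
             u u')
    (sym (h-rule-ηR γ (rule β (ηR α ∷ []))))

  horizontal-idˡ : {f f' : Tm (A ∷ []) B} (u : id₁ ∘₁ f ≈ f) (u' : id₁ ∘₁ f' ≈ f') (α : Cell f f') →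
                   tr u u' (α * id₂ id₁) ≡ α
  horizontal-idˡ u u' α = trans (cong (tr u u') (h-whisker (var here) (ηR α) (h-unit α)))
    (trans (cong (tr u u') (h-unit α)) (tr-id u u' α))

  horizontal-idʳ : {f f' : Tm (A ∷ []) B} (u : f ∘₁ id₁ ≈ f) (u' : f' ∘₁ id₁ ≈ f') (α : Cell f f') →
                   tr u u' (id₂ id₁ * α) ≡ α
  horizontal-idʳ u u' α = trans (cong (tr u u') (h-rule-ηR α (reflR (var here))))
    (trans (h-resp (≅sym (conv-elim _ _ _)) u u') (h-unit α))

  𝓕-is2Category : Is2Category (𝓕 X h)
  𝓕-is2Category = record
    { ≈₁-refl     = ≈refl
    ; ≈₁-sym      = ≈sym
    ; ≈₁-trans    = ≈trans
    ; trc-id      = tr-id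
    ; trc-trc     = tr-tr
    ; ∘₁-cong     = λ {_} {_} {_} {f} {f'} {g} {g'} p q → ≈trans (sub-cong q (f ∷ [])) (sub-congʳ g' (p ∷ []))
    ; id₂-trc     = λ p q → h-resp (~⇒≅ (reflR-cong p)) p q
    ; ·-trc       = λ p q r α β → h-resp (~⇒≅ (~⨾ (ηR-tr p q α) (ηR-tr q r β))) p r
    ; *-trc       = λ p p' q q' u u' α β →
                      h-resp (~⇒≅ (~trans (~rule β (ηR-tr p p' α ∷ [])) (~sym (~rule-tr q q' β _)))) u u'
    ; ∘₁-assoc    = λ f g k → sub-sub k (g ∷ []) (f ∷ [])
    ; ∘₁-idˡ      = λ f → ≈refl
    ; ∘₁-idʳ      = sub-id
    ; ·-assoc     = vertical-assoc
    ; ·-idˡ       = vertical-idˡ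
    ; ·-idʳ       = vertical-idʳ
    ; interchange = interchange
    ; *-id₂       = horizontal-id₂
    ; *-assoc     = horizontal-assoc
    ; *-idˡ       = horizontal-idˡ
    ; *-idʳ       = horizontal-idʳ
    }

module CartesianClosedStructure (X : Sig₂)
  (h : ∀ {G A M N} → Reductions.Red (Sig₂.Rule X) G A M N → Sig₂.Rule X G A M N)
  (alg : IsAlgebra X h) where

  open Sig₂ X
  open Syntax Op
  open Reductions Rule
  open Permutation Rule tr
  open SubstitutionLemmas Op
  open AlgebraLemmas X h alg
  open IsAlgebra alg
  open LMap {R₁ = Red} {R₂ = Rule} h
  open Mult Rule
  open TwoCatData (𝓕 X h) using (Cell; id₁; _∘₁_; id₂; _·_; _*_)
  module Term = Syntax Op
  module Perm = Permutation Rule tr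

  private variable
    A A' A'' B B' B'' : Ty Sort

  π₁ : Tm ((A ⊗ B) ∷ []) A
  π₁ = fst (var here)

  π₂ : Tm ((A ⊗ B) ∷ []) B
  π₂ = snd (var here)

  ev : Tm ((A ⊗ (A ⇒ B)) ∷ []) B
  ev = app (snd (var here)) (fst (var here))

  _⊗₁_ : Tm (A ∷ []) A' → Tm (B ∷ []) B' → Tm ((A ⊗ B) ∷ []) (A' ⊗ B')
  f ⊗₁ g = pair (sub f (π₁ ∷ [])) (sub g (π₂ ∷ []))

  _⊗₂_ : {f f' : Tm (A ∷ []) A'} {g g' : Tm (B ∷ []) B'} → Cell f f' → Cell g g' → Cell (f ⊗₁ g) (f' ⊗₁ g')
  α ⊗₂ β = h (rpair (rule α (rfst (rvar here) ∷ [])) (rule β (rsnd (rvar here) ∷ [])))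

  ⊗₁-∘ : (f : Tm (A ∷ []) A') (f' : Tm (A' ∷ []) A'') (g : Tm (B ∷ []) B') (g' : Tm (B' ∷ []) B'') →
         (f' ∘₁ f) ⊗₁ (g' ∘₁ g) ≈ (f' ⊗₁ g') ∘₁ (f ⊗₁ g)
  ⊗₁-∘ f f' g g' = pair-cong
    (≈trans (sub-sub f' (f ∷ []) (π₁ ∷ []))
      (≈trans (sub-congʳ f' (≈sym (Term.β-fst _ _) ∷ [])) (≈sym (sub-sub f' (π₁ ∷ []) ((f ⊗₁ g) ∷ [])))))
    (≈trans (sub-sub g' (g ∷ []) (π₂ ∷ []))
      (≈trans (sub-congʳ g' (≈sym (Term.β-snd _ _) ∷ [])) (≈sym (sub-sub g' (π₂ ∷ []) ((f ⊗₁ g) ∷ [])))))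

  ⊗₂-id : (f : Tm (A ∷ []) A') (g : Tm (B ∷ []) B') → id₂ f ⊗₂ id₂ g ≡ id₂ (f ⊗₁ g)
  ⊗₂-id f g = h-coherence
    (R₂.rpair (R₂.rule (reflR f) (R₂.reflR π₁ R₂.∷ R₂.[])) (R₂.rule (reflR g) (R₂.reflR π₂ R₂.∷ R₂.[])))
    (~⇒≅ (~rpair (~rule _ (≡⇒~ (Lmap-reflR _) ∷ [])) (~rule _ (≡⇒~ (Lmap-reflR _) ∷ []))))
    (~⇒≅ (~rpair (reflR-subst-identity f (≡⇒~ (μ-reflR _) ∷ [])) (reflR-subst-identity g (≡⇒~ (μ-reflR _) ∷ []))))

  ⊗₂-· : {f₁ f₂ f₃ : Tm (A ∷ []) A'} {g₁ g₂ g₃ : Tm (B ∷ []) B'}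
         (α : Cell f₁ f₂) (α' : Cell f₂ f₃) (β : Cell g₁ g₂) (β' : Cell g₂ g₃) →
         (α · α') ⊗₂ (β · β') ≡ (α ⊗₂ β) · (α' ⊗₂ β')
  ⊗₂-· α α' β β' = trans
    (h-coherence (R₂.rpair (R₂.rule (ηR α ⨾ ηR α') (R₂.reflR π₁ R₂.∷ R₂.[]))
                           (R₂.rule (ηR β ⨾ ηR β') (R₂.reflR π₂ R₂.∷ R₂.[])))
      (~⇒≅ (~rpair (~rule _ (≡⇒~ (Lmap-reflR _) ∷ [])) (~rule _ (≡⇒~ (Lmap-reflR _) ∷ []))))
      (≅trans (~⇒≅ (~rpair
                 (~trans (subst-identity (ηR α ⨾ ηR α') (≡⇒~ (μ-reflR π₁) ∷ []))
                         (~⨾ (ηR-instance α _) (ηR-instance α' _)))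
                 (~trans (subst-identity (ηR β ⨾ ηR β') (≡⇒~ (μ-reflR π₂) ∷ []))
                         (~⨾ (ηR-instance β _) (ηR-instance β' _)))))
              (rpair-⨾ _ _ _ _)))
    (sym (h-⨾ _ _))

  -- both sides are h of ⟨α'⟨α⟨π₁⟩⟩, β'⟨β⟨π₂⟩⟩⟩
  ⊗₂-* : {f₁ f₂ : Tm (A ∷ []) A'} {f₁' f₂' : Tm (A' ∷ []) A''}
         {g₁ g₂ : Tm (B ∷ []) B'} {g₁' g₂' : Tm (B' ∷ []) B''}
         (u : (f₁' ∘₁ f₁) ⊗₁ (g₁' ∘₁ g₁) ≈ (f₁' ⊗₁ g₁') ∘₁ (f₁ ⊗₁ g₁))
         (u' : (f₂' ∘₁ f₂) ⊗₁ (g₂' ∘₁ g₂) ≈ (f₂' ⊗₁ g₂') ∘₁ (f₂ ⊗₁ g₂))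
         (α : Cell f₁ f₂) (α' : Cell f₁' f₂') (β : Cell g₁ g₂) (β' : Cell g₁' g₂') →
         tr u u' ((α * α') ⊗₂ (β * β')) ≡ (α ⊗₂ β) * (α' ⊗₂ β')
  ⊗₂-* {f₁ = f₁} {f₂} {f₁'} {f₂'} {g₁} {g₂} {g₁'} {g₂'} u u' α α' β β' =
    trans (h-coherence-tr Φˡ
             (~⇒≅ (~rpair (~rule _ (≡⇒~ (Lmap-reflR _) ∷ [])) (~rule _ (≡⇒~ (Lmap-reflR _) ∷ []))))
             (≅trans (~⇒≅ μΦˡ) (≅sym μΦʳ)) u u')
    (trans (sym (h-mult Φʳ)) (trans (h-≅ LmapΦʳ) (sym (h-rule-ηR (h outer) inner))))
    where
    inner : Red _ _ (f₁ ⊗₁ g₁) (f₂ ⊗₁ g₂)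
    inner = rpair (rule α (rfst (rvar here) ∷ [])) (rule β (rsnd (rvar here) ∷ []))
    outer : Red _ _ (f₁' ⊗₁ g₁') (f₂' ⊗₁ g₂')
    outer = rpair (rule α' (rfst (rvar here) ∷ [])) (rule β' (rsnd (rvar here) ∷ []))
    composite : Red _ _ (pair (f₁' ∘₁ (f₁ ∘₁ π₁)) (g₁' ∘₁ (g₁ ∘₁ π₂)))
                        (pair (f₂' ∘₁ (f₂ ∘₁ π₁)) (g₂' ∘₁ (g₂ ∘₁ π₂)))
    composite = rpair (rule α' (rule α (rfst (rvar here) ∷ []) ∷ [])) (rule β' (rule β (rsnd (rvar here) ∷ []) ∷ []))
    Φˡ : R₂.Red _ _ ((f₁' ∘₁ f₁) ⊗₁ (g₁' ∘₁ g₁)) ((f₂' ∘₁ f₂) ⊗₁ (g₂' ∘₁ g₂))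
    Φˡ = R₂.rpair (R₂.rule (rule α' (ηR α ∷ [])) (R₂.reflR π₁ R₂.∷ R₂.[]))
                  (R₂.rule (rule β' (ηR β ∷ [])) (R₂.reflR π₂ R₂.∷ R₂.[]))
    μΦˡ : μ Φˡ ~ composite
    μΦˡ = ~rpair
      (~trans (subst-identity (rule α' (ηR α ∷ [])) (≡⇒~ (μ-reflR π₁) ∷ []))
              (~trans (~conv _ _ _) (~rule α' (ηR-instance α _ ∷ []))))
      (~trans (subst-identity (rule β' (ηR β ∷ [])) (≡⇒~ (μ-reflR π₂) ∷ []))
              (~trans (~conv _ _ _) (~rule β' (ηR-instance β _ ∷ []))))
    Ψ : R₂.Red _ _ (f₁ ⊗₁ g₁) (f₂ ⊗₁ g₂)
    Ψ = R₂.rpair (R₂.rule (ηR α) (R₂.reflR π₁ R₂.∷ R₂.[])) (R₂.rule (ηR β) (R₂.reflR π₂ R₂.∷ R₂.[]))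
    Φʳ : R₂.Red _ _ ((f₁' ⊗₁ g₁') ∘₁ (f₁ ⊗₁ g₁)) ((f₂' ⊗₁ g₂') ∘₁ (f₂ ⊗₁ g₂))
    Φʳ = R₂.rule outer (Ψ R₂.∷ R₂.[])
    LmapΦʳ : Lmap Φʳ ≅ rule (h outer) (inner ∷ [])
    LmapΦʳ = ~⇒≅ (~rule _ (~rpair
      (~trans (~rule _ (≡⇒~ (Lmap-reflR _) ∷ [])) (≡⇒~ (cong (λ z → rule z (rfst (rvar here) ∷ [])) (h-unit α))))
      (~trans (~rule _ (≡⇒~ (Lmap-reflR _) ∷ [])) (≡⇒~ (cong (λ z → rule z (rsnd (rvar here) ∷ [])) (h-unit β)))) ∷ []))
    μΨ : μ Ψ ~ inner
    μΨ = ~rpair (~trans (subst-identity (ηR α) (≡⇒~ (μ-reflR _) ∷ [])) (ηR-instance α _))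
                (~trans (subst-identity (ηR β) (≡⇒~ (μ-reflR _) ∷ [])) (ηR-instance β _))
    μΦʳ : μ Φʳ ≅ composite
    μΦʳ = ≅trans (⨾-cong (~⇒≅ (~rpair (~conv _ _ _) (~conv _ _ _)))
                        (~⇒≅ (~rpair (~trans (sub-whisker f₂' (π₁ ∷ []) (μ Ψ ∷ [])) (whisker-cong f₂' (~rfst μΨ ∷ [])))
                                     (~trans (sub-whisker g₂' (π₂ ∷ []) (μ Ψ ∷ [])) (whisker-cong g₂' (~rsnd μΨ ∷ []))))))
          (≅trans (≅sym (rpair-⨾ _ _ _ _))
          (rpair-cong
            (≅trans (≅sym (rule-⨾ʳ α' (rfst (reflR (f₁ ⊗₁ g₁)) ∷ []) (rfst inner ∷ [])))
              (rule-cong α' (≅trans (≅sym (rfst-⨾ (reflR (f₁ ⊗₁ g₁)) inner))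
                                    (≅trans (rfst-cong (⨾-unitˡ inner)) (Perm.β-fst _ _)) ∷ [])))
            (≅trans (≅sym (rule-⨾ʳ β' (rsnd (reflR (f₁ ⊗₁ g₁)) ∷ []) (rsnd inner ∷ [])))
              (rule-cong β' (≅trans (≅sym (rsnd-⨾ (reflR (f₁ ⊗₁ g₁)) inner))
                                    (≅trans (rsnd-cong (⨾-unitˡ inner)) (Perm.β-snd _ _)) ∷ [])))))

  -- 2-cells into a product correspond to pairs of 2-cells (β-fst, β-snd, η-pair)
  module ProductCells {D A B : Ty Sort} {f g : Tm (D ∷ []) (A ⊗ B)} where

    pairRed : Red (D ∷ []) A (fst f) (fst g) → Red (D ∷ []) B (snd f) (snd g) → Red (D ∷ []) (A ⊗ B) f g
    pairRed P Q = conv (≈sym (Term.η-pair f)) (≈sym (Term.η-pair g)) (rpair P Q)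

    h-pairRed : (P : Red (D ∷ []) A (fst f) (fst g)) (Q : Red (D ∷ []) B (snd f) (snd g)) →
                h (pairRed (ηR (h P)) (ηR (h Q))) ≡ h (pairRed P Q)
    h-pairRed P Q = h-coherence (R₂.conv (≈sym (Term.η-pair f)) (≈sym (Term.η-pair g)) (R₂.rpair (R₂.ηR P) (R₂.ηR Q)))
      (~⇒≅ (~trans (~conv _ _ _) (~trans (~rpair (Lmap-ηR P) (Lmap-ηR Q)) (~sym (~conv _ _ _)))))
      (~⇒≅ (~trans (~conv _ _ _) (~trans (~rpair (μ-ηR P) (μ-ηR Q)) (~sym (~conv _ _ _)))))

    proj₁-whisker : (α : Cell f g) → α * id₂ π₁ ≡ h (rfst (ηR α))
    proj₁-whisker α = h-whisker π₁ (ηR α) (h-unit α)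

    proj₂-whisker : (α : Cell f g) → α * id₂ π₂ ≡ h (rsnd (ηR α))
    proj₂-whisker α = h-whisker π₂ (ηR α) (h-unit α)

    ηR-pairRed : (α : Cell f g) → ηR α ≅ pairRed (rfst (ηR α)) (rsnd (ηR α))
    ηR-pairRed α = ≅trans (Perm.η-pair (ηR α)) (≅sym (conv-elim _ _ _))

    product-hom-inj : (α β : Cell f g) → (α * id₂ π₁ , α * id₂ π₂) ≡ (β * id₂ π₁ , β * id₂ π₂) → α ≡ β
    product-hom-inj α β e =
      trans (sym (h-unit α)) (trans (h-≅ (ηR-pairRed α)) (trans (sym (h-pairRed _ _))
        (trans (cong₂ (λ x y → h (pairRed (ηR x) (ηR y))) fst-eq snd-eq)
        (trans (h-pairRed _ _) (trans (sym (h-≅ (ηR-pairRed β))) (h-unit β))))))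
      where
      fst-eq : h (rfst (ηR α)) ≡ h (rfst (ηR β))
      fst-eq = trans (sym (proj₁-whisker α)) (trans (cong proj₁ e) (proj₁-whisker β))
      snd-eq : h (rsnd (ηR α)) ≡ h (rsnd (ηR β))
      snd-eq = trans (sym (proj₂-whisker α)) (trans (cong proj₂ e) (proj₂-whisker β))

    product-hom-surj : (γ : Cell (fst f) (fst g) × Cell (snd f) (snd g)) →
                       Σ (Cell f g) (λ α → (α * id₂ π₁ , α * id₂ π₂) ≡ γ)
    product-hom-surj (γ₁ , γ₂) = h (pairRed (ηR γ₁) (ηR γ₂)) , cong₂ _,_ fst-eq snd-eq
      where
      fst-eq : h (pairRed (ηR γ₁) (ηR γ₂)) * id₂ π₁ ≡ γ₁
      fst-eq = trans (h-whisker π₁ (pairRed (ηR γ₁) (ηR γ₂)) refl)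
                 (trans (h-≅ (≅trans (rfst-cong (conv-elim _ _ _)) (Perm.β-fst _ _))) (h-unit γ₁))
      snd-eq : h (pairRed (ηR γ₁) (ηR γ₂)) * id₂ π₂ ≡ γ₂
      snd-eq = trans (h-whisker π₂ (pairRed (ηR γ₁) (ηR γ₂)) refl)
                 (trans (h-≅ (≅trans (rsnd-cong (conv-elim _ _ _)) (Perm.β-snd _ _))) (h-unit γ₂))

  -- 1-cells and 2-cells into an exponential correspond to those out of a
  -- product, by currying (β-lam, η-lam)
  module ExponentialCells {D A B : Ty Sort} where

    pairVars : Tm (A ∷ D ∷ []) (A ⊗ D)
    pairVars = pair (var here) (var (there here))

    uncurry : Tm (D ∷ []) (A ⇒ B) → Tm ((A ⊗ D) ∷ []) B
    uncurry f = ev ∘₁ (id₁ ⊗₁ f)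

    curry : Tm ((A ⊗ D) ∷ []) B → Tm (D ∷ []) (A ⇒ B)
    curry k = lam (sub k (pairVars ∷ []))

    curry-uncurry : (f : Tm (D ∷ []) (A ⇒ B)) → curry (uncurry f) ≈ f
    curry-uncurry f = ≈trans (lam-cong (≈trans (app-cong (Term.β-snd _ _) (Term.β-fst _ _))
      (≈trans (app-cong (sub-sub f _ _) (Term.β-fst _ _))
      (≈trans (app-cong (sub-congʳ f (Term.β-snd _ _ ∷ [])) ≈refl)
        (app-cong (≈sym (ren-sub there f)) ≈refl))))) (≈sym (Term.η-lam f))

    uncurry-curry : (k : Tm ((A ⊗ D) ∷ []) B) → uncurry (curry k) ≈ k
    uncurry-curry k = ≈trans (app-cong (Term.β-snd _ _) (Term.β-fst _ _))
      (≈trans (Term.β-lam _ _)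
      (≈trans (sub-cong (sub-sub k _ _) _)
      (≈trans (sub-sub k _ _)
      (≈trans (sub-congʳ k (≈sym (Term.η-pair (var here)) ∷ [])) (sub-id k)))))

    uncurry-unfold : (f : Tm (D ∷ []) (A ⇒ B)) → app (sub f (π₂ ∷ [])) π₁ ≈ uncurry f
    uncurry-unfold f = app-cong (≈sym (Term.β-snd _ _)) (≈sym (Term.β-fst _ _))

    module _ {f g : Tm (D ∷ []) (A ⇒ B)} where

      uncurryRed : Cell f g → Red ((A ⊗ D) ∷ []) B (uncurry f) (uncurry g)
      uncurryRed α = conv (uncurry-unfold f) (uncurry-unfold g) (rapp (rule α (rsnd (rvar here) ∷ [])) (rfst (rvar here)))

      curryRed : Cell (uncurry f) (uncurry g) → Red (D ∷ []) (A ⇒ B) f g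
      curryRed k = conv (curry-uncurry f) (curry-uncurry g) (rlam (rule k (reflR pairVars ∷ [])))

      uncurry-action : (α : Cell f g) → (id₂ id₁ ⊗₂ α) * id₂ ev ≡ h (uncurryRed α)
      uncurry-action α = trans (h-whisker ev id⊗α refl)
        (h-coherence (R₂.conv (uncurry-unfold f) (uncurry-unfold g)
                        (R₂.rapp (R₂.rule (ηR α) (R₂.reflR π₂ R₂.∷ R₂.[]))
                                 (R₂.rule (reflR (var here)) (R₂.reflR π₁ R₂.∷ R₂.[]))))
          (≅trans (~⇒≅ (~trans (~conv _ _ _)
                    (~rapp (~trans (~rule _ (≡⇒~ (Lmap-reflR _) ∷ []))
                                   (≡⇒~ (cong (λ z → rule z (rsnd (rvar here) ∷ [])) (h-unit α))))
                           (~rule _ (≡⇒~ (Lmap-reflR _) ∷ [])))))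
                  (≅sym (rapp-cong (Perm.β-snd _ _) (Perm.β-fst _ _))))
          (~⇒≅ (~trans (~conv _ _ _) (~trans (~rapp (~trans (subst-identity (ηR α) (≡⇒~ (μ-reflR _) ∷ [])) (ηR-instance α _))
                                                     (reflR-subst-identity (var here) (≡⇒~ (μ-reflR _) ∷ [])))
                                             (~sym (~conv _ _ _))))))
        where
        id⊗α : Red ((A ⊗ D) ∷ []) (A ⊗ (A ⇒ B)) (id₁ ⊗₁ f) (id₁ ⊗₁ g)
        id⊗α = rpair (rule (id₂ id₁) (rfst (rvar here) ∷ [])) (rule α (rsnd (rvar here) ∷ []))

      weaken-ηR : (α : Cell f g) → renR (there {B = A}) (ηR α) ~ rule α (rvar (there here) ∷ [])
      weaken-ηR α = ~trans (~conv _ _ _) (~trans (~conv _ _ _) (~conv _ _ _))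

      -- currying after uncurrying: η-lam for reductions
      curryRed-uncurryRed : (α : Cell f g) → h (curryRed (h (uncurryRed α))) ≡ α
      curryRed-uncurryRed α = trans (h-coherence
          (R₂.conv (curry-uncurry f) (curry-uncurry g) (R₂.rlam (R₂.rule (uncurryRed α) (R₂.reflR pairVars R₂.∷ R₂.[]))))
          (~⇒≅ (~trans (~conv _ _ _) (~trans (~rlam (~rule _ (≡⇒~ (Lmap-reflR _) ∷ []))) (~sym (~conv _ _ _)))))
          (≅trans (~⇒≅ (~trans (~conv _ _ _) (~rlam (~trans (subst-identity (uncurryRed α) (≡⇒~ (μ-reflR _) ∷ []))
                                                  (~trans (~conv _ _ _) (~rapp (~conv _ _ _) ~refl))))))
          (≅trans (rlam-cong (≅trans (rapp-cong (rule-cong α (Perm.β-snd _ _ ∷ [])) (Perm.β-fst _ _))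
                                     (~⇒≅ (~rapp (~sym (weaken-ηR α)) ~refl))))
                  (≅sym (Perm.η-lam (ηR α))))))
        (h-unit α)

      -- uncurrying after currying: β-lam for reductions
      uncurryRed-curryRed : (γ : Cell (uncurry f) (uncurry g)) → h (uncurryRed (h (curryRed γ))) ≡ γ
      uncurryRed-curryRed γ = trans (h-coherence Φ
          (~⇒≅ (~trans (~conv _ _ _) (~trans (~rapp (~rule _ (≡⇒~ (Lmap-reflR _) ∷ [])) (≡⇒~ (Lmap-reflR _)))
                                             (~sym (~conv _ _ _)))))
          (≅trans (~⇒≅ μΦ) (≅trans (Perm.β-lam _ _) (~⇒≅ β-reduct))))
        (h-unit γ)
        where
        Φ : R₂.Red ((A ⊗ D) ∷ []) B (uncurry f) (uncurry g)
        Φ = R₂.conv (uncurry-unfold f) (uncurry-unfold g)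
              (R₂.rapp (R₂.rule (curryRed γ) (R₂.reflR π₂ R₂.∷ R₂.[])) (R₂.reflR π₁))
        pairVars' : Tm (A ∷ (A ⊗ D) ∷ []) (A ⊗ D)
        pairVars' = sub pairVars (lift (π₂ ∷ []))
        μΦ : μ Φ ~ rapp (rlam (rule γ (reflR pairVars' ∷ []))) (rfst (rvar here))
        μΦ = ~trans (~conv _ _ _) (~rapp
               (~trans (subst-identity (curryRed γ) (≡⇒~ (μ-reflR _) ∷ []))
                 (~trans (~conv _ _ _) (~rlam (~trans (~conv _ _ _)
                   (~rule γ (≡⇒~ (reflR-subʳ pairVars (lift (π₂ ∷ []))) ∷ []))))))
               (≡⇒~ (μ-reflR _)))
        β-reduct : (rule γ (reflR pairVars' ∷ []) ⟦ rfst (rvar here) ∷ reflRs (idTms ((A ⊗ D) ∷ [])) ⟧) ~ ηR γ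
        β-reduct = ~trans (subst-identity (rule γ (reflR pairVars' ∷ []))
                                          (~s-refl (rfst (rvar here) ∷ reflRs (idTms ((A ⊗ D) ∷ [])))))
                   (~trans (~conv _ _ _)
                     (~trans (~rule γ (~trans (≡⇒~ (reflR-subʳ pairVars' (π₁ ∷ var here ∷ [])))
                                              (reflR-cong (≈sym (Term.η-pair (var here)))) ∷ []))
                             (~sym (~conv _ _ _))))

      exponential-hom-inj : (α β : Cell f g) → (id₂ id₁ ⊗₂ α) * id₂ ev ≡ (id₂ id₁ ⊗₂ β) * id₂ ev → α ≡ β
      exponential-hom-inj α β e = trans (sym (curryRed-uncurryRed α))
        (trans (cong (λ z → h (curryRed z)) (trans (sym (uncurry-action α)) (trans e (uncurry-action β))))
               (curryRed-uncurryRed β))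

      exponential-hom-surj : (γ : Cell (uncurry f) (uncurry g)) →
                             Σ (Cell f g) (λ α → (id₂ id₁ ⊗₂ α) * id₂ ev ≡ γ)
      exponential-hom-surj γ = h (curryRed γ) , trans (uncurry-action (h (curryRed γ))) (uncurryRed-curryRed γ)

  open ProductCells
  open ExponentialCells

  𝓕-cartesianClosed : CartesianClosed (𝓕 X h) 𝟙 _⊗_ (λ A B → A ⇒ B)
  𝓕-cartesianClosed = record
    { _⊗₁_    = _⊗₁_
    ; _⊗₂_    = _⊗₂_
    ; ⊗₁-cong = λ p q → pair-cong (sub-cong p _) (sub-cong q _)
    ; ⊗₂-trc  = λ p p' q q' u u' α β →
                  h-resp (~⇒≅ (~rpair (~sym (~rule-tr p p' α _)) (~sym (~rule-tr q q' β _)))) u u'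
    ; ⊗₁-id   = ≈sym (Term.η-pair (var here))
    ; ⊗₁-∘    = ⊗₁-∘
    ; ⊗₂-id   = ⊗₂-id
    ; ⊗₂-·    = ⊗₂-·
    ; ⊗₂-*    = ⊗₂-*
    ; π₁      = π₁
    ; π₂      = π₂
    ; ev      = ev
    -- η-unit, on terms and on reductions
    ; terminal = λ D → record
        { ob-inj   = λ f g _ → ≈trans (Term.η-unit f) (≈sym (Term.η-unit g))
        ; ob-surj  = λ _ → unit , tt
        ; hom-inj  = λ α β _ → trans (sym (h-unit α))
            (trans (h-≅ (≅trans (Perm.η-unit (ηR α)) (≅sym (Perm.η-unit (ηR β))))) (h-unit β))
        ; hom-surj = λ {f} {g} _ → h (conv (≈sym (Term.η-unit f)) (≈sym (Term.η-unit g)) runit) , refl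
        }
    ; product = λ D A B → record
        { ob-inj   = λ f g e → ≈trans (Term.η-pair f) (≈trans (pair-cong (proj₁ e) (proj₂ e)) (≈sym (Term.η-pair g)))
        ; ob-surj  = λ fg → pair (proj₁ fg) (proj₂ fg) , (Term.β-fst _ _ , Term.β-snd _ _)
        ; hom-inj  = product-hom-inj
        ; hom-surj = product-hom-surj
        }
    ; exponential = λ D A B → record
        { ob-inj   = λ f g e → ≈trans (≈sym (curry-uncurry f)) (≈trans (lam-cong (sub-cong e _)) (curry-uncurry g))
        ; ob-surj  = λ k → curry k , uncurry-curry k
        ; hom-inj  = exponential-hom-inj
        ; hom-surj = exponential-hom-surj
        }
    }

proposition7p10 : (X : Sig₂)
    → (h : ∀ {G A M N} → Reductions.Red (Sig₂.Rule X) G A M N → Sig₂.Rule X G A M N)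
    → IsAlgebra X h
    → Σ (Is2Category (𝓕 X h)) (λ _ → CartesianClosed (𝓕 X h) 𝟙 _⊗_ (λ A B → A ⇒ B))
proposition7p10 X h alg =
  TwoCategory.𝓕-is2Category X h alg , CartesianClosedStructure.𝓕-cartesianClosed X h alg
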